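{- Let $m\ge 1$ and let $\nu_1,\ldots,\nu_m,l_1,\ldots,l_m$ be positive integers with $1\le \nu_j\le l_j$ for $j=1,\ldots,m$; put $M:=\nu_1+\ldots+\nu_m$ and $L:=l_1+\ldots+l_m$ (so $M\le L$). Let $a_1,\ldots,a_m\in\mathbb{Z}$ and $\overline{a}=(a_1,\ldots,a_m)^T$. Let $\mathcal{V}(\overline{a})$ be the $M\times(L+1)$ integer matrix whose rows are indexed by the pairs $(j,i)$ with $j=1,\ldots,m$ and $i=1,\ldots,\nu_j$ (ordered lexicographically), whose columns are indexed by $h=0,1,\ldots,L$, and whose entry in row $(j,i)$ and column $h$ is $\binom{L+i}{h}a_j^{L-h}$. Let $D(\overline{a})$ be the greatest common divisor of all the $M\times M$ minors of $\mathcal{V}(\overline{a})$. Then, in $\mathbb{Z}$, $$ \left(\prod_{1\le j\le m} a_j^{\binom{\nu_j}{2}}\right)\prod_{1\le i<j\le m}(a_i-a_j)^{\min\{\nu_i^2,\,\nu_j^2\}}\ \Big|\ D(\overline{a}). $$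
   Context: Here $x^0=1$ for every integer $x$ (including $0$), and $\binom{1}{2}=0$. The greatest common divisor of a family of integers that are all zero is $0$. -}

module Defs where

open import Algebra.Definitions.RawMonoid using () renaming (sum to fold)
open import Data.Bool.Base using (if_then_else_)
open import Data.Fin.Base using (Fin; zero; suc; toℕ; punchIn; splitAt)
open import Data.Fin.Properties using (_<?_)
open import Data.Integer.Base using (ℤ; +_; 0ℤ; 1ℤ; -1ℤ; _*_; _^_; +-0-rawMonoid; *-1-rawMonoid)
open import Data.Integer.GCD using (gcd)
open import Data.List.Base as List using (List; []; _∷_; _++_)
open import Data.Nat.Base as ℕ using (ℕ; zero; suc; _∸_)
open import Data.Nat.Combinatorics using (_C_)
open import Data.Product.Base using (Σ; _,_; map)
open import Data.Sum.Base using ([_,_]′)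
open import Data.Vec.Base as Vec using (Vec; []; _∷_; lookup)
open import Data.Vec.Functional using (Vector; tail)
open import Function.Base using (id)
open import Relation.Nullary.Decidable.Core using (does)

sumℕ : ∀ {n} → Vector ℕ n → ℕ
sumℕ = fold ℕ.+-0-rawMonoid

sumℤ : ∀ {n} → Vector ℤ n → ℤ
sumℤ = fold +-0-rawMonoid

productℤ : ∀ {n} → Vector ℤ n → ℤ
productℤ = fold *-1-rawMonoid

Matrix : ℕ → ℕ → Set
Matrix m n = Fin m → Fin n → ℤ

-- Laplace expansion along the first row.
det : ∀ {n} → Matrix n n → ℤ
det {zero}  A = 1ℤ
det {suc n} A =
  sumℤ λ c → -1ℤ ^ toℕ c * A zero c * det (λ r d → A (suc r) (punchIn c d))

-- All strictly increasing sequences of length k in Fin n, each listed once.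
increasing : ∀ k n → List (Vec (Fin n) k)
increasing zero    n       = [] ∷ []
increasing (suc k) zero    = []
increasing (suc k) (suc n) =
  List.map (λ cs → zero ∷ Vec.map suc cs) (increasing k n) ++
  List.map (Vec.map suc) (increasing (suc k) n)

maximalMinors : ∀ {m n} → Matrix m n → List ℤ
maximalMinors {m} {n} A =
  List.map (λ cs → det (λ r c → A r (lookup cs c))) (increasing m n)

gcdList : List ℤ → ℤ
gcdList = List.foldr gcd 0ℤ

-- The lexicographic enumeration of the pairs (j , i) with i in Fin (ν j).
rowIndex : ∀ {m} (ν : Vector ℕ m) → Fin (sumℕ ν) → Σ (Fin m) (λ j → Fin (ν j))
rowIndex {suc m} ν r =
  [ (λ i → zero , i) , (λ r′ → map suc id (rowIndex (tail ν) r′)) ]′ (splitAt (ν zero) r)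

-- Here i counts from 0, so the 1-based index of the row is suc (toℕ i);
-- the truncated subtraction is exact because toℕ h ≤ L.
𝒱-entry : ∀ {m} (L : ℕ) {ν : Vector ℕ m} → Vector ℤ m →
          Σ (Fin m) (λ j → Fin (ν j)) → Fin (suc L) → ℤ
𝒱-entry L a (j , i) h = + ((L ℕ.+ suc (toℕ i)) C toℕ h) * a j ^ (L ∸ toℕ h)

𝒱 : ∀ {m} (ν l : Vector ℕ m) → Vector ℤ m → Matrix (sumℕ ν) (suc (sumℕ l))
𝒱 ν l a r h = 𝒱-entry (sumℕ l) {ν} a (rowIndex ν r) h

D : ∀ {m} (ν l : Vector ℕ m) → Vector ℤ m → ℤ
D ν l a = gcdList (maximalMinors (𝒱 ν l a))

product-< : ∀ {m} → (Fin m → Fin m → ℤ) → ℤ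
product-< f = productℤ λ i → productℤ λ j → if does (i <? j) then f i j else 1ℤ

{-# OPTIONS --safe #-}
module Submission where

-- Write x for the vector a, read as a tuple of indeterminates, and fix a maximal minor. It suffices
-- to show that the minor is divisible, as a polynomial, by each power x_j ^ C(ν_j , 2) and by each
-- power (x_i - x_j) ^ min(ν_i² , ν_j²), because the linear forms x_j and x_i - x_j are pairwise
-- coprime. A linear form ℓ is prime, the quotient by it being the substitution that solves ℓ = 0.
--
-- If n rows of a matrix are of the form ∑ ε ^ d c_d z_d with the same vectors z_d, then
-- multilinearity gives the factor ε ^ (0 + 1 + … + (n - 1)) in the determinant. This handles x_j
-- at once. For x_p - x_q =: ε with n = ν_p ≤ ν_q, the scaled row x_p ^ (i + 1) * row (p , i) has the
-- entries C(L + i + 1 , h) x_p ^ (L + i + 1 - h). Taylor expansion at x_q writes it as a combination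
-- of rows of block q plus ε ^ (i + 1) ∑ ε ^ d c_d z_d. This yields the exponent
-- (1 + … + n) + (0 + … + (n - 1)) = n², and the power of x_p introduced by the scaling is coprime to ε.
-- (Rows are counted by i = 0 , … , n - 1 here.)

open import Defs
open import Algebra.Properties.CommutativeSemigroup as CommutativeSemigroup using ()
open import Algebra.Properties.Semiring.Sum as Sum using ()
open import Data.Bool.Base using (if_then_else_)
open import Data.Fin.Base using (Fin; zero; suc; toℕ; fromℕ<; punchIn; _↑ˡ_; _↑ʳ_) renaming (_<_ to _<ᶠ_)
import Data.Fin.Properties as Fin
open import Data.Integer.Base using (ℤ; +_; -[1+_]; 0ℤ; 1ℤ; -1ℤ; ∣_∣; _+_; _*_; _-_; _^_; -_)
open import Data.Integer.Divisibility.Signed as ℤ using (_∣_)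
open import Data.Integer.GCD using (gcd-greatest)
open import Data.Integer.Properties using
  ( +-*-semiring; *-commutativeSemigroup; *-assoc; *-comm; *-identityˡ; *-zeroʳ; +-identityʳ; +-injective; pos-+
  ; ^-distribˡ-+-*; i*j≡0⇒i≡0∨j≡0; i-j≡0⇒i≡j; i≡j⇒i-j≡0 )
open import Data.Integer.Tactic.RingSolver using (solve-∀)
open import Data.List.Base using (List; []; _∷_; length; map; foldr; tabulate; allFin)
open import Data.List.Membership.Propositional.Properties using (∈-allFin)
open import Data.List.Properties using (length-map; length-tabulate; map-tabulate; tabulate-cong)
open import Data.List.Relation.Unary.All as All using (All; []; _∷_)
import Data.List.Relation.Unary.All.Properties as All
open import Data.List.Relation.Unary.AllPairs using ([]; _∷_)
open import Data.List.Relation.Unary.Unique.Propositional using (Unique)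
import Data.List.Relation.Unary.Unique.Propositional.Properties as Unique
open import Data.Nat.Base as ℕ using (ℕ; zero; suc; _∸_; _≤_; _<_; _⊓_)
open import Data.Nat.Combinatorics using (_C_; nCk+nC[k+1]≡[n+1]C[k+1]; nC1≡n; k>n⇒nCk≡0)
import Data.Nat.Divisibility as ℕ
open import Data.Nat.ListAction using (sum)
import Data.Nat.Properties as ℕ
open import Data.Nat.Tactic.RingSolver using () renaming (solve-∀ to solveℕ-∀)
open import Data.Product.Base using (Σ; _,_; proj₁)
open import Data.Sum.Base using ([_,_]′)
open import Data.Vec.Base using (lookup)
open import Data.Vec.Functional using (Vector; tail; updateAt)
open import Data.Vec.Functional.Properties using (updateAt-updates; updateAt-minimal)
open import Function.Base using (_∘_; const; id)
open import Relation.Binary.PropositionalEquality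
open import Relation.Nullary using (Dec; yes; no; does; contradiction)
open import Relation.Nullary.Decidable using (from-no)

open CommutativeSemigroup *-commutativeSemigroup using (x∙yz≈y∙xz; xy∙z≈y∙xz)

-- Determinants

module ∑ = Sum +-*-semiring

sum-zero : ∀ {n} {f : Vector ℤ n} → (∀ i → f i ≡ 0ℤ) → sumℤ f ≡ 0ℤ
sum-zero {zero}  f≡0 = refl
sum-zero {suc n} f≡0 = cong₂ _+_ (f≡0 zero) (sum-zero (f≡0 ∘ suc))

sum-linear : ∀ {n} x y (f g : Vector ℤ n) →
             sumℤ (λ i → x * f i + y * g i) ≡ x * sumℤ f + y * sumℤ g
sum-linear x y f g = trans (∑.∑-distrib-+ (λ i → x * f i) (λ i → y * g i))
  (sym (cong₂ _+_ (∑.*-distribˡ-sum x f) (∑.*-distribˡ-sum y g)))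

minor : ∀ {n} → Matrix (suc n) (suc n) → Fin (suc n) → Matrix n n
minor A c r d = A (suc r) (punchIn c d)

det-cong : ∀ {n} (A B : Matrix n n) → (∀ r c → A r c ≡ B r c) → det A ≡ det B
det-cong {zero}  A B A≡B = refl
det-cong {suc n} A B A≡B = ∑.sum-cong-≗ λ c →
  cong₂ _*_ (cong (-1ℤ ^ toℕ c *_) (A≡B zero c)) (det-cong (minor A c) (minor B c) λ r d → A≡B (suc r) (punchIn c d))

-- Three matrices are compared entrywise because the induction on `q` passes to minors, whose rows
-- agree only entry by entry.
det-row-linear : ∀ {n} (q : Fin n) x y (A B R : Matrix n n) →
  (∀ r → r ≢ q → ∀ c → R r c ≡ A r c) →
  (∀ r → r ≢ q → ∀ c → R r c ≡ B r c) →
  (∀ c → R q c ≡ x * A q c + y * B q c) →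
  det R ≡ x * det A + y * det B
det-row-linear zero x y A B R RA RB Rq = trans (∑.sum-cong-≗ term)
  (sum-linear x y (λ c → -1ℤ ^ toℕ c * A zero c * det (minor A c)) (λ c → -1ℤ ^ toℕ c * B zero c * det (minor B c)))
  where
  rearrange : ∀ s x y a b d → s * (x * a + y * b) * d ≡ x * (s * a * d) + y * (s * b * d)
  rearrange = solve-∀
  term : ∀ c → _ ≡ _
  term c = trans (cong (λ t → -1ℤ ^ toℕ c * t * det (minor R c)) (Rq c))
    (trans (rearrange (-1ℤ ^ toℕ c) x y (A zero c) (B zero c) _)
      (cong₂ (λ s t → x * (-1ℤ ^ toℕ c * A zero c * s) + y * (-1ℤ ^ toℕ c * B zero c * t))
        (det-cong (minor R c) (minor A c) λ r d → RA (suc r) (λ ()) _) (det-cong (minor R c) (minor B c) λ r d → RB (suc r) (λ ()) _)))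
det-row-linear (suc q) x y A B R RA RB Rq = trans (∑.sum-cong-≗ term)
  (sum-linear x y (λ c → -1ℤ ^ toℕ c * A zero c * det (minor A c)) (λ c → -1ℤ ^ toℕ c * B zero c * det (minor B c)))
  where
  rearrange : ∀ s x y a b → s * (x * a + y * b) ≡ x * (s * a) + y * (s * b)
  rearrange = solve-∀
  term : ∀ c → _ ≡ _
  term c = trans
    (cong (-1ℤ ^ toℕ c * R zero c *_)
      (det-row-linear q x y (minor A c) (minor B c) (minor R c)
        (λ r r≢q d → RA (suc r) (r≢q ∘ Fin.suc-injective) _)
        (λ r r≢q d → RB (suc r) (r≢q ∘ Fin.suc-injective) _)
        (λ d → Rq (punchIn c d))))
    (trans (rearrange (-1ℤ ^ toℕ c * R zero c) x y _ _)
      (cong₂ (λ s t → x * (-1ℤ ^ toℕ c * s * det (minor A c)) + y * (-1ℤ ^ toℕ c * t * det (minor B c)))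
        (RA zero (λ ()) c) (RB zero (λ ()) c)))

-- The terms of the double sum cancel in pairs, (c , d) against the pair that deletes the
-- same two columns in the opposite order; those involving column 0 are paired explicitly.
double-expansion-vanishes : ∀ k (u : Vector ℤ (2 ℕ.+ k)) (F : (Fin k → Fin (2 ℕ.+ k)) → ℤ) →
  (∀ {φ ψ} → φ ≗ ψ → F φ ≡ F ψ) →
  sumℤ (λ c → -1ℤ ^ toℕ c * u c *
    sumℤ (λ d → -1ℤ ^ toℕ d * u (punchIn c d) * F (punchIn c ∘ punchIn d))) ≡ 0ℤ
double-expansion-vanishes k u F F-cong = begin
  1ℤ * u zero * X + sumℤ (λ c → -1ℤ * s c * v c * (1ℤ * u zero * G c + R c))
    ≡⟨ cong (λ t → 1ℤ * u zero * X + t) (∑.sum-cong-≗ λ c → rearrange (u zero) (s c) (v c) (G c) (R c)) ⟩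
  1ℤ * u zero * X + sumℤ (λ c → - u zero * (s c * v c * G c) + 1ℤ * (- (s c * v c * R c)))
    ≡⟨ cong (λ t → 1ℤ * u zero * X + t) (sum-linear (- u zero) 1ℤ (λ c → s c * v c * G c) (λ c → - (s c * v c * R c))) ⟩
  1ℤ * u zero * X + (- u zero * X + 1ℤ * sumℤ (λ c → - (s c * v c * R c)))
    ≡⟨ cong (λ t → 1ℤ * u zero * X + (- u zero * X + 1ℤ * t)) (remaining k u F F-cong) ⟩
  1ℤ * u zero * X + (- u zero * X + 1ℤ * 0ℤ)
    ≡⟨ cancel (u zero) X ⟩
  0ℤ ∎
  where
  open ≡-Reasoning
  s : ∀ {n} → Fin n → ℤ
  s c = -1ℤ ^ toℕ c
  v : Vector ℤ (suc k)
  v = u ∘ suc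
  G : Fin (suc k) → ℤ
  G d = F (suc ∘ punchIn d)
  X : ℤ
  X = sumℤ (λ d → s d * v d * G d)
  R : Fin (suc k) → ℤ
  R c = sumℤ (λ d → -1ℤ * s d * u (suc (punchIn c d)) * F (punchIn (suc c) ∘ punchIn (suc d)))
  rearrange : ∀ u₀ s v g r → -1ℤ * s * v * (1ℤ * u₀ * g + r) ≡ - u₀ * (s * v * g) + 1ℤ * (- (s * v * r))
  rearrange = solve-∀
  cancel : ∀ u X → 1ℤ * u * X + (- u * X + 1ℤ * 0ℤ) ≡ 0ℤ
  cancel = solve-∀
  -- Here neither deleted column is column 0. The selection therefore keeps column 0 and is a `lift`
  -- of a selection among the other columns, to which the induction applies with `u ∘ suc` and `F′`.
  remaining : ∀ k (u : Vector ℤ (2 ℕ.+ k)) (F : (Fin k → Fin (2 ℕ.+ k)) → ℤ) →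
    (∀ {φ ψ} → φ ≗ ψ → F φ ≡ F ψ) →
    sumℤ (λ c → - (-1ℤ ^ toℕ c * u (suc c) *
      sumℤ (λ d → -1ℤ * -1ℤ ^ toℕ d * u (suc (punchIn c d)) * F (punchIn (suc c) ∘ punchIn (suc d))))) ≡ 0ℤ
  remaining zero    u F F-cong = sum-zero λ c → cong -_ (*-zeroʳ (-1ℤ ^ toℕ c * u (suc c)))
  remaining (suc k) u F F-cong = trans (∑.sum-cong-≗ term)
    (double-expansion-vanishes k (u ∘ suc) F′ λ φ≗ψ → F-cong (lift-cong φ≗ψ))
    where
    lift : ∀ {a b} → (Fin a → Fin b) → Fin (suc a) → Fin (suc b)
    lift φ zero    = zero
    lift φ (suc i) = suc (φ i)
    lift-cong : ∀ {a b} {φ ψ : Fin a → Fin b} → φ ≗ ψ → lift φ ≗ lift ψ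
    lift-cong φ≗ψ zero    = refl
    lift-cong φ≗ψ (suc i) = cong suc (φ≗ψ i)
    F′ : (Fin k → Fin (2 ℕ.+ k)) → ℤ
    F′ φ = F (lift φ)
    lift-punchIn : ∀ {n} (c : Fin (2 ℕ.+ n)) (d : Fin (suc n)) →
      punchIn (suc c) ∘ punchIn (suc d) ≗ lift (punchIn c ∘ punchIn d)
    lift-punchIn c d zero    = refl
    lift-punchIn c d (suc i) = refl
    sign : ∀ s u f → -1ℤ * s * u * f ≡ -1ℤ * (s * u * f)
    sign = solve-∀
    neg : ∀ p X → - (p * (-1ℤ * X)) ≡ p * X
    neg = solve-∀
    term : ∀ c → _ ≡ _
    term c = trans
      (cong (λ t → - (-1ℤ ^ toℕ c * u (suc c) * t))
        (trans (∑.sum-cong-≗ λ d →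
            trans (sign (-1ℤ ^ toℕ d) _ _)
              (cong (λ t → -1ℤ * (-1ℤ ^ toℕ d * u (suc (punchIn c d)) * t)) (F-cong (lift-punchIn c d))))
          (sym (∑.*-distribˡ-sum -1ℤ λ d → -1ℤ ^ toℕ d * u (suc (punchIn c d)) * F (lift (punchIn c ∘ punchIn d))))))
      (neg (-1ℤ ^ toℕ c * u (suc c)) (sumℤ λ d → -1ℤ ^ toℕ d * u (suc (punchIn c d)) * F (lift (punchIn c ∘ punchIn d))))

-- Replacing one row; the determinant is alternating

_[_≔_] : ∀ {n p} → Matrix n p → Fin n → Vector ℤ p → Matrix n p
A [ q ≔ v ] = updateAt A q (const v)

≔-updates : ∀ {n p} (A : Matrix n p) q v → (A [ q ≔ v ]) q ≡ v
≔-updates A q v = updateAt-updates q A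

≔-minimal : ∀ {n p} (A : Matrix n p) {q r} v → r ≢ q → (A [ q ≔ v ]) r ≡ A r
≔-minimal A {q} {r} v r≢q = updateAt-minimal r q A r≢q

det-≔-linear : ∀ {n} (A : Matrix n n) q x y v w →
  det (A [ q ≔ (λ c → x * v c + y * w c) ]) ≡ x * det (A [ q ≔ v ]) + y * det (A [ q ≔ w ])
det-≔-linear A q x y v w = det-row-linear q x y (A [ q ≔ v ]) (A [ q ≔ w ]) _
  (λ r r≢q c → trans (cong-app (≔-minimal A _ r≢q) c) (sym (cong-app (≔-minimal A v r≢q) c)))
  (λ r r≢q c → trans (cong-app (≔-minimal A _ r≢q) c) (sym (cong-app (≔-minimal A w r≢q) c)))
  (λ c → trans (cong-app (≔-updates A q _) c)
    (sym (cong₂ (λ a b → x * a + y * b) (cong-app (≔-updates A q v) c) (cong-app (≔-updates A q w) c))))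

det-≔-cong : ∀ {n} (A : Matrix n n) q {v w} → (∀ c → v c ≡ w c) → det (A [ q ≔ v ]) ≡ det (A [ q ≔ w ])
det-≔-cong A q {v} {w} v≡w = det-cong _ _ entry
  where
  entry : ∀ r c → (A [ q ≔ v ]) r c ≡ (A [ q ≔ w ]) r c
  entry r c with r Fin.≟ q
  ... | yes refl = trans (cong-app (≔-updates A q v) c) (trans (v≡w c) (sym (cong-app (≔-updates A q w) c)))
  ... | no r≢q   = trans (cong-app (≔-minimal A v r≢q) c) (sym (cong-app (≔-minimal A w r≢q) c))

det-≔-self : ∀ {n} (A : Matrix n n) q → det (A [ q ≔ A q ]) ≡ det A
det-≔-self A q = det-cong _ _ entry
  where
  entry : ∀ r c → (A [ q ≔ A q ]) r c ≡ A r c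
  entry r c with r Fin.≟ q
  ... | yes refl = cong-app (≔-updates A q (A q)) c
  ... | no r≢q   = cong-app (≔-minimal A (A q) r≢q) c

Alternating : ∀ {n} → (Matrix n n → ℤ) → Set
Alternating {n} f = ∀ A p q → p ≢ q → (∀ c → A p c ≡ A q c) → f A ≡ 0ℤ

det-suc-suc : ∀ {n} → Alternating (det {n}) → ∀ (A : Matrix (suc n) (suc n)) p q → p ≢ q →
              (∀ c → A (suc p) c ≡ A (suc q) c) → det A ≡ 0ℤ
det-suc-suc alt A p q p≢q eq = sum-zero λ c →
  trans (cong (-1ℤ ^ toℕ c * A zero c *_) (alt (minor A c) p q p≢q λ d → eq (punchIn c d)))
    (*-zeroʳ (-1ℤ ^ toℕ c * A zero c))

det-zero-suc : ∀ {n} → Alternating (det {n}) → ∀ (A : Matrix (suc n) (suc n)) q →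
               (∀ c → A zero c ≡ A (suc q) c) → det A ≡ 0ℤ
-- The equal rows are 0 and 1. Expanding along both gives the double sum, where `F φ` is the
-- determinant of the remaining rows on the columns `φ`.
det-zero-suc {suc k} alt A zero eq = trans
  (∑.sum-cong-≗ λ c → cong (-1ℤ ^ toℕ c * A zero c *_) (∑.sum-cong-≗ λ d →
    cong (λ t → -1ℤ ^ toℕ d * t * det (minor (minor A c) d)) (sym (eq (punchIn c d)))))
  (double-expansion-vanishes k (A zero) (λ φ → det (λ r e → A (suc (suc r)) (φ e)))
    λ φ≗ψ → det-cong _ _ λ r e → cong (A (suc (suc r))) (φ≗ψ e))
-- With u the repeated row and w row 1, expand the determinant with w + u in row 1 and in
-- row suc q, which vanishes because these rows repeat and do not include row 0.
det-zero-suc {suc k} alt A (suc q) eq = trans (sym unchanged) goal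
  where
  u w : Vector ℤ (2 ℕ.+ k)
  u = A zero
  w = A (suc zero)
  B : Vector ℤ (2 ℕ.+ k) → Vector ℤ (2 ℕ.+ k) → Matrix (2 ℕ.+ k) (2 ℕ.+ k)
  B x y = (A [ suc zero ≔ x ]) [ suc (suc q) ≔ y ]
  w+u : Vector ℤ (2 ℕ.+ k)
  w+u c = 1ℤ * w c + 1ℤ * u c
  last : ∀ x y c → B x y (suc (suc q)) c ≡ y c
  last x y c = cong-app (≔-updates (A [ suc zero ≔ x ]) (suc (suc q)) y) c
  unchanged : det (B w u) ≡ det A
  unchanged = trans (det-≔-cong (A [ suc zero ≔ w ]) (suc (suc q)) eq)
    (trans (det-≔-self (A [ suc zero ≔ w ]) (suc (suc q))) (det-≔-self A (suc zero)))
  repeated : ∀ x → det (B x x) ≡ 0ℤ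
  repeated x = det-suc-suc alt (B x x) zero (suc q) (λ ()) (λ c → sym (last x x c))
  leading : ∀ y → det (B u y) ≡ 0ℤ
  leading y = det-zero-suc alt (B u y) zero (λ c → refl)
  drop : ∀ b → 1ℤ * b + 1ℤ * 0ℤ ≡ b
  drop = solve-∀
  drop′ : ∀ b → 1ℤ * 0ℤ + 1ℤ * b ≡ b
  drop′ = solve-∀
  step₁ : det (B w+u w+u) ≡ det (B w w+u)
  step₁ = trans (det-row-linear (suc zero) 1ℤ 1ℤ (B w w+u) (B u w+u) (B w+u w+u)
    (λ { zero _ c → refl ; (suc zero) ne c → contradiction refl ne ; (suc (suc r)) _ c → refl })
    (λ { zero _ c → refl ; (suc zero) ne c → contradiction refl ne ; (suc (suc r)) _ c → refl })
    (λ c → refl)) (trans (cong (λ t → 1ℤ * det (B w w+u) + 1ℤ * t) (leading w+u)) (drop (det (B w w+u))))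
  step₂ : det (B w w+u) ≡ det (B w u)
  step₂ = trans (det-≔-linear (A [ suc zero ≔ w ]) (suc (suc q)) 1ℤ 1ℤ w u)
    (trans (cong (λ t → 1ℤ * t + 1ℤ * det (B w u)) (repeated w)) (drop′ (det (B w u))))
  goal : det (B w u) ≡ 0ℤ
  goal = trans (sym (trans step₁ step₂)) (repeated w+u)

det-alternating : ∀ {n} → Alternating (det {n})
det-alternating A zero    zero    p≢q eq = contradiction refl p≢q
det-alternating A zero    (suc q) p≢q eq = det-zero-suc det-alternating A q eq
det-alternating A (suc p) zero    p≢q eq = det-zero-suc det-alternating A p (λ c → sym (eq c))
det-alternating A (suc p) (suc q) p≢q eq = det-suc-suc det-alternating A p q (p≢q ∘ cong suc) eq

-- Polynomial functions, divisibility and coprimality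

3i≢1 : ∀ i → i * + 3 ≢ 1ℤ
3i≢1 i eq = from-no (3 ℕ.∣? 1) (ℤ.∣⇒∣ᵤ (ℤ.divides {+ 3} i (sym eq)))

3i≡0⇒i≡0 : ∀ {i} → i * + 3 ≡ 0ℤ → i ≡ 0ℤ
3i≡0⇒i≡0 {i} eq = [ (λ e → e) , (λ ()) ]′ (i*j≡0⇒i≡0∨j≡0 i eq)

-- A unit congruent to 1 modulo 3 cannot be -1, since 3 does not divide 2. This is the reason for
-- the factor 3 in `no-zero-divisors`.
1+3i∣1⇒i≡0 : ∀ i {q} → i * + 3 ≡ q - 1ℤ → q ∣ 1ℤ → i ≡ 0ℤ
1+3i∣1⇒i≡0 i {q} eq q∣1 with q | eq | ℕ.∣1⇒≡1 (ℤ.∣⇒∣ᵤ q∣1)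
... | + .1     | eq | refl = 3i≡0⇒i≡0 eq
... | -[1+ 0 ] | eq | refl = contradiction (ℤ.∣⇒∣ᵤ (ℤ.divides {+ 3} i (sym eq))) (from-no (3 ℕ.∣? 2))

-- Since ℤ is an infinite domain, integer polynomials in m variables are
-- the same as the functions ℤᵐ → ℤ which they induce.
data IsPolynomial {m} : (Vector ℤ m → ℤ) → Set where
  constant   : ∀ k → IsPolynomial (λ _ → k)
  coordinate : ∀ i → IsPolynomial (λ ρ → ρ i)
  _⊕_        : ∀ {f g} → IsPolynomial f → IsPolynomial g → IsPolynomial (λ ρ → f ρ + g ρ)
  _⊗_        : ∀ {f g} → IsPolynomial f → IsPolynomial g → IsPolynomial (λ ρ → f ρ * g ρ)
  respects   : ∀ {f g} → (∀ ρ → f ρ ≡ g ρ) → IsPolynomial f → IsPolynomial g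

_⊖_ : ∀ {m} {f g : Vector ℤ m → ℤ} → IsPolynomial f → IsPolynomial g → IsPolynomial (λ ρ → f ρ - g ρ)
_⊖_ {f = f} {g} F G = respects (λ ρ → eq (f ρ) (g ρ)) (F ⊕ (constant -1ℤ ⊗ G))
  where
  eq : ∀ x y → x + -1ℤ * y ≡ x - y
  eq = solve-∀

power : ∀ {m} {f : Vector ℤ m → ℤ} → IsPolynomial f → ∀ e → IsPolynomial (λ ρ → f ρ ^ e)
power F zero    = constant 1ℤ
power F (suc e) = F ⊗ power F e

infix 4 _∣ᴾ_
-- A polynomial quotient is more than divisibility of all values: 2 divides every value of x (x +
-- 1), but not the polynomial.
record _∣ᴾ_ {m} (g f : Vector ℤ m → ℤ) : Set where
  constructor divides
  field
    {quotient} : Vector ℤ m → ℤ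
    polynomial : IsPolynomial quotient
    equality   : ∀ ρ → f ρ ≡ g ρ * quotient ρ

module _ {m : ℕ} where

  private
    Fun : Set
    Fun = Vector ℤ m → ℤ

  ∣ᴾ-respects : ∀ {g f f′ : Fun} → (∀ ρ → f ρ ≡ f′ ρ) → g ∣ᴾ f → g ∣ᴾ f′
  ∣ᴾ-respects f≡f′ (divides Q eq) = divides Q λ ρ → trans (sym (f≡f′ ρ)) (eq ρ)

  ∣ᴾ-respectsˡ : ∀ {g g′ f : Fun} → (∀ ρ → g ρ ≡ g′ ρ) → g ∣ᴾ f → g′ ∣ᴾ f
  ∣ᴾ-respectsˡ g≡g′ (divides {q} Q eq) = divides Q λ ρ → trans (eq ρ) (cong (_* q ρ) (g≡g′ ρ))

  1∣ᴾ : ∀ {f : Fun} → IsPolynomial f → (λ _ → 1ℤ) ∣ᴾ f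
  1∣ᴾ {f} F = divides F λ ρ → sym (*-identityˡ (f ρ))

  ∣ᴾ-+ : ∀ {h f g : Fun} → h ∣ᴾ f → h ∣ᴾ g → h ∣ᴾ (λ ρ → f ρ + g ρ)
  ∣ᴾ-+ {h} (divides {p} P f≡hp) (divides {q} Q g≡hq) = divides (P ⊕ Q) λ ρ →
    trans (cong₂ _+_ (f≡hp ρ) (g≡hq ρ)) (eq (h ρ) (p ρ) (q ρ))
    where
    eq : ∀ h p q → h * p + h * q ≡ h * (p + q)
    eq = solve-∀

  ∣ᴾ-multiple : ∀ {h g f : Fun} → IsPolynomial g → h ∣ᴾ f → h ∣ᴾ (λ ρ → g ρ * f ρ)
  ∣ᴾ-multiple {h} {g} {f} G (divides {q} Q eq) = divides (G ⊗ Q) λ ρ →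
    trans (cong (g ρ *_) (eq ρ)) (x∙yz≈y∙xz (g ρ) (h ρ) (q ρ))

  -- The only property of polynomials that enters `no-zero-divisors`. For products, a c - b d = (a -
  -- b) c + b (c - d).
  polynomial-congruence : ∀ {f : Fun} → IsPolynomial f → ∀ {k ρ σ} →
    (∀ i → k ∣ ρ i - σ i) → k ∣ f ρ - f σ
  polynomial-congruence (constant c) k∣ = subst (_ ∣_) (sym (eq c)) (ℤ.divides 0ℤ refl)
    where
    eq : ∀ c → c - c ≡ 0ℤ
    eq = solve-∀
  polynomial-congruence (coordinate i) k∣ = k∣ i
  polynomial-congruence (_⊕_ {f} {g} F G) {k} {ρ} {σ} k∣ =
    subst (k ∣_) (eq (f ρ) (f σ) (g ρ) (g σ))
      (ℤ.∣m∣n⇒∣m+n (polynomial-congruence F k∣) (polynomial-congruence G k∣))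
    where
    eq : ∀ a b c d → (a - b) + (c - d) ≡ (a + c) - (b + d)
    eq = solve-∀
  polynomial-congruence (_⊗_ {f} {g} F G) {k} {ρ} {σ} k∣ =
    subst (k ∣_) (eq (f ρ) (f σ) (g ρ) (g σ))
      (ℤ.∣m∣n⇒∣m+n (ℤ.∣m⇒∣m*n (g ρ) (polynomial-congruence F k∣)) (ℤ.∣n⇒∣m*n (f σ) (polynomial-congruence G k∣)))
    where
    eq : ∀ a b c d → (a - b) * c + b * (c - d) ≡ a * c - b * d
    eq = solve-∀
  polynomial-congruence (respects f≡g F) {k} {ρ} {σ} k∣ =
    subst (k ∣_) (cong₂ _-_ (f≡g ρ) (f≡g σ)) (polynomial-congruence F k∣)

  -- Put G = g v and q = 1 + 3 G (f ρ). The point w = ρ + q (v - ρ) is congruent to v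
  -- modulo 3 G, so that g w ≠ 0, and to ρ modulo q, so that q divides f ρ - f w = f ρ.
  no-zero-divisors : ∀ {f g : Fun} → IsPolynomial f → IsPolynomial g → ∀ {v} → g v ≢ 0ℤ →
    (∀ ρ → g ρ * f ρ ≡ 0ℤ) → ∀ ρ → f ρ ≡ 0ℤ
  no-zero-divisors {f} {g} F G {v} gv≢0 gf≡0 ρ =
    [ (λ gw≡0 → contradiction gw≡0 gw≢0) , fw≡0⇒fρ≡0 ]′ (i*j≡0⇒i≡0∨j≡0 (g w) (gf≡0 w))
    where
    w : Vector ℤ m
    w i = ρ i + (1ℤ + g v * + 3 * f ρ) * (v i - ρ i)
    cancel : ∀ {x} → g v * x ≡ 0ℤ → x ≡ 0ℤ
    cancel {x} eq = [ (λ e → contradiction e gv≢0) , (λ e → e) ]′ (i*j≡0⇒i≡0∨j≡0 (g v) eq)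
    gw≢0 : g w ≢ 0ℤ
    gw≢0 gw≡0 = absurd (polynomial-congruence G {g v * + 3} {v} {w}
      (λ i → ℤ.divides (f ρ * (ρ i - v i)) (eq (v i) (ρ i) (g v * + 3) (f ρ))))
      where
      eq : ∀ v r N f → v - (r + (1ℤ + N * f) * (v - r)) ≡ f * (r - v) * N
      eq = solve-∀
      factor : ∀ G k t → G * (k * t - 1ℤ) ≡ k * (G * t) - G
      factor = solve-∀
      self : ∀ x → x - 0ℤ - x ≡ 0ℤ
      self = solve-∀
      absurd : g v * + 3 ∣ g v - g w → _
      absurd (ℤ.divides k gv-gw≡kN) = 3i≢1 k (i-j≡0⇒i≡j (k * + 3) 1ℤ (cancel (trans (factor (g v) k (+ 3))
        (trans (cong (_- g v) (trans (sym gv-gw≡kN) (cong (λ t → g v - t) gw≡0))) (self (g v))))))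
    fw≡0⇒fρ≡0 : f w ≡ 0ℤ → f ρ ≡ 0ℤ
    -- Since q = 1 + 3 G (f ρ) divides `f ρ`, it divides 1, and so G (f ρ) = 0.
    fw≡0⇒fρ≡0 fw≡0 = cancel (1+3i∣1⇒i≡0 (g v * f ρ) (eq (g v) (f ρ) (+ 3))
      (ℤ.∣m+n∣n⇒∣m ℤ.∣-refl (ℤ.∣n⇒∣m*n (g v * + 3) q∣fρ)))
      where
      eq : ∀ a b t → a * b * t ≡ 1ℤ + a * t * b - 1ℤ
      eq = solve-∀
      w-congruent : ∀ v r q → r - (r + q * (v - r)) ≡ (r - v) * q
      w-congruent = solve-∀
      q∣fρ : 1ℤ + g v * + 3 * f ρ ∣ f ρ
      q∣fρ = subst ((1ℤ + g v * + 3 * f ρ) ∣_) (trans (cong (λ t → f ρ - t) fw≡0) (+-identityʳ (f ρ)))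
        (polynomial-congruence F {1ℤ + g v * + 3 * f ρ} {ρ} {w}
          (λ i → ℤ.divides (ρ i - v i) (w-congruent (v i) (ρ i) (1ℤ + g v * + 3 * f ρ))))

  -- In other words, `g` is not a zero divisor modulo `h`. This form of coprimality is what
  -- combining divisors requires, and it avoids gcds and unique factorization of polynomials.
  record _CoprimeTo_ (g h : Fun) : Set where
    field
      cancel : ∀ {f} → IsPolynomial f → h ∣ᴾ (λ ρ → g ρ * f ρ) → h ∣ᴾ f
  open _CoprimeTo_ public

  cancel-factor : ∀ {g f h : Fun} {v} → IsPolynomial g → IsPolynomial f → IsPolynomial h → g v ≢ 0ℤ →
    (∀ ρ → g ρ * f ρ ≡ g ρ * h ρ) → ∀ ρ → f ρ ≡ h ρ
  cancel-factor {g} {f} {h} {v} G F H gv≢0 eq ρ = i-j≡0⇒i≡j (f ρ) (h ρ)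
    (no-zero-divisors (F ⊖ H) G {v} gv≢0
      (λ σ → trans (distrib (g σ) (f σ) (h σ)) (i≡j⇒i-j≡0 (eq σ))) ρ)
    where
    distrib : ∀ g f h → g * (f - h) ≡ g * f - g * h
    distrib = solve-∀

  -- Cancelling modulo ℓ gives f = ℓ f′. One factor ℓ is then removed from g f = ℓ ^ (e + 1) q,
  -- which is possible because ℓ is nonzero at `v`, and induction applies to f′.
  power-coprime : ∀ {g ℓ : Fun} {v} → IsPolynomial g → IsPolynomial ℓ → ℓ v ≢ 0ℤ →
    g CoprimeTo ℓ → ∀ e → g CoprimeTo (λ ρ → ℓ ρ ^ e)
  power-coprime G Λ ℓv≢0 coprime zero .cancel F _ = 1∣ᴾ F
  power-coprime {g} {ℓ} {v} G Λ ℓv≢0 coprime (suc e) .cancel {f} F (divides {q} Q gf≡ℓ^q) =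
    raise (coprime .cancel F (divides (power Λ e ⊗ Q) λ ρ → trans (gf≡ℓ^q ρ) (*-assoc (ℓ ρ) (ℓ ρ ^ e) (q ρ))))
    where
    raise : ℓ ∣ᴾ f → (λ ρ → ℓ ρ ^ suc e) ∣ᴾ f
    raise (divides {f′} F′ f≡ℓf′) = conclude (power-coprime G Λ ℓv≢0 coprime e .cancel F′ (divides Q gf′≡ℓ^q))
      where
      gf′≡ℓ^q : ∀ ρ → g ρ * f′ ρ ≡ ℓ ρ ^ e * q ρ
      gf′≡ℓ^q = cancel-factor Λ (G ⊗ F′) (power Λ e ⊗ Q) ℓv≢0 λ ρ →
        trans (x∙yz≈y∙xz (ℓ ρ) (g ρ) (f′ ρ)) (trans (cong (g ρ *_) (sym (f≡ℓf′ ρ)))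
          (trans (gf≡ℓ^q ρ) (*-assoc (ℓ ρ) (ℓ ρ ^ e) (q ρ))))
      conclude : (λ ρ → ℓ ρ ^ e) ∣ᴾ f′ → (λ ρ → ℓ ρ ^ suc e) ∣ᴾ f
      conclude (divides {q′} Q′ f′≡) = divides Q′ λ ρ →
        trans (f≡ℓf′ ρ) (trans (cong (ℓ ρ *_) (f′≡ ρ)) (sym (*-assoc (ℓ ρ) (ℓ ρ ^ e) (q′ ρ))))

  module _ (i : Fin m) {t : Fun} (T : IsPolynomial t) where

    eliminate : Vector ℤ m → Vector ℤ m
    eliminate ρ = updateAt ρ i (const (t ρ))

    eliminate-polynomial : ∀ {f} → IsPolynomial f → IsPolynomial (f ∘ eliminate)
    eliminate-polynomial (constant k) = constant k
    eliminate-polynomial (coordinate k) with k Fin.≟ i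
    ... | yes refl = respects (λ ρ → sym (updateAt-updates i ρ)) T
    ... | no k≢i   = respects (λ ρ → sym (updateAt-minimal k i ρ k≢i)) (coordinate k)
    eliminate-polynomial (F ⊕ G) = eliminate-polynomial F ⊕ eliminate-polynomial G
    eliminate-polynomial (F ⊗ G) = eliminate-polynomial F ⊗ eliminate-polynomial G
    eliminate-polynomial (respects f≡g F) = respects (λ ρ → f≡g (eliminate ρ)) (eliminate-polynomial F)

    -- Division by the linear form x_i - t with the substituted polynomial as remainder, by
    -- induction on the construction of `f`. A product is treated by changing one factor at a time.
    factor-theorem : ∀ {f} → IsPolynomial f → (λ ρ → ρ i - t ρ) ∣ᴾ (λ ρ → f ρ - f (eliminate ρ))
    factor-theorem (constant k) = divides (constant 0ℤ) λ ρ → eq k (ρ i - t ρ)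
      where
      eq : ∀ k x → k - k ≡ x * 0ℤ
      eq = solve-∀
    factor-theorem (coordinate k) with k Fin.≟ i
    ... | yes refl = divides (constant 1ℤ) λ ρ →
      trans (cong (λ x → ρ i - x) (updateAt-updates i ρ)) (eq (ρ i - t ρ))
      where
      eq : ∀ x → x ≡ x * 1ℤ
      eq = solve-∀
    ... | no k≢i = divides (constant 0ℤ) λ ρ →
      trans (cong (λ x → ρ k - x) (updateAt-minimal k i ρ k≢i)) (eq (ρ k) (ρ i - t ρ))
      where
      eq : ∀ k x → k - k ≡ x * 0ℤ
      eq = solve-∀
    factor-theorem (_⊕_ {f} {g} F G) =
      ∣ᴾ-respects (λ ρ → eq (f ρ) (f (eliminate ρ)) (g ρ) (g (eliminate ρ)))
        (∣ᴾ-+ (factor-theorem F) (factor-theorem G))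
      where
      eq : ∀ a b c d → (a - b) + (c - d) ≡ (a + c) - (b + d)
      eq = solve-∀
    factor-theorem (_⊗_ {f} {g} F G) =
      ∣ᴾ-respects (λ ρ → eq (f ρ) (f (eliminate ρ)) (g ρ) (g (eliminate ρ)))
        (∣ᴾ-+ (∣ᴾ-multiple G (factor-theorem F)) (∣ᴾ-multiple (eliminate-polynomial F) (factor-theorem G)))
      where
      eq : ∀ a b c d → c * (a - b) + b * (c - d) ≡ a * c - b * d
      eq = solve-∀
    factor-theorem (respects f≡g F) =
      ∣ᴾ-respects (λ ρ → cong₂ _-_ (f≡g ρ) (f≡g (eliminate ρ))) (factor-theorem F)

    -- Substituting x_i = t in g f = ℓ q annihilates ℓ, because `t` does not change under the
    -- substitution. As `g` stays nonzero, `f` must become zero, and `factor-theorem` makes ℓ divide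
    -- it.
    linear-coprime : (∀ ρ → t (eliminate ρ) ≡ t ρ) → ∀ {g v} → IsPolynomial g →
      g (eliminate v) ≢ 0ℤ → g CoprimeTo (λ ρ → ρ i - t ρ)
    linear-coprime t-inv {g} {v} G gv≢0 .cancel {f} F (divides {q} Q gf≡ℓq) =
      ∣ᴾ-respects (λ ρ → trans (cong (λ x → f ρ - x) (f-eliminate≡0 ρ)) (+-identityʳ (f ρ))) (factor-theorem F)
      where
      zeroˡ : ∀ {s} t q → s ≡ t → (s - t) * q ≡ 0ℤ
      zeroˡ t q refl = eq t q
        where
        eq : ∀ t q → (t - t) * q ≡ 0ℤ
        eq = solve-∀
      f-eliminate≡0 : ∀ ρ → f (eliminate ρ) ≡ 0ℤ
      f-eliminate≡0 = no-zero-divisors (eliminate-polynomial F) (eliminate-polynomial G) {v} gv≢0 λ ρ →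
        trans (gf≡ℓq (eliminate ρ))
          (zeroˡ (t (eliminate ρ)) (q (eliminate ρ)) (trans (updateAt-updates i ρ) (sym (t-inv ρ))))

-- Determinants with polynomial entries

det-split : ∀ {n} (A : Matrix n n) q x y v w → (∀ c → A q c ≡ x * v c + y * w c) →
            det A ≡ x * det (A [ q ≔ v ]) + y * det (A [ q ≔ w ])
det-split A q x y v w eq = trans (sym (det-≔-self A q))
  (trans (det-≔-cong A q eq) (det-≔-linear A q x y v w))

det-zero-row : ∀ {n} (A : Matrix n n) q → (∀ c → A q c ≡ 0ℤ) → det A ≡ 0ℤ
det-zero-row A q eq = trans (det-split A q 0ℤ 0ℤ (A q) (A q) (λ c → trans (eq c) (zeroes (A q c)))) (sym (zeroes (det (A [ q ≔ A q ]))))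
  where
  zeroes : ∀ x → 0ℤ ≡ 0ℤ * x + 0ℤ * x
  zeroes = solve-∀

PolynomialMatrix : ∀ {m n p} → (Vector ℤ m → Matrix n p) → Set
PolynomialMatrix A = ∀ r c → IsPolynomial (λ ρ → A ρ r c)

sum-polynomial : ∀ {m n} {f : Fin n → Vector ℤ m → ℤ} → (∀ i → IsPolynomial (f i)) →
                 IsPolynomial (λ ρ → sumℤ (λ i → f i ρ))
sum-polynomial {n = zero}  F = constant 0ℤ
sum-polynomial {n = suc n} F = F zero ⊕ sum-polynomial (F ∘ suc)

det-polynomial : ∀ {m n} {A : Vector ℤ m → Matrix n n} → PolynomialMatrix A →
                 IsPolynomial (λ ρ → det (A ρ))
det-polynomial {n = zero}  P = constant 1ℤ
det-polynomial {n = suc n} P = sum-polynomial λ c →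
  (constant (-1ℤ ^ toℕ c) ⊗ P zero c) ⊗ det-polynomial (λ r d → P (suc r) (punchIn c d))

≔-polynomial : ∀ {m n p} {A : Vector ℤ m → Matrix n p} {v : Vector ℤ m → Vector ℤ p} q →
  PolynomialMatrix A → (∀ c → IsPolynomial (λ ρ → v ρ c)) → PolynomialMatrix (λ ρ → A ρ [ q ≔ v ρ ])
≔-polynomial {A = A} {v} q P V r c with r Fin.≟ q
... | yes refl = respects (λ ρ → sym (cong-app (≔-updates (A ρ) q (v ρ)) c)) (V c)
... | no r≢q   = respects (λ ρ → sym (cong-app (≔-minimal (A ρ) (v ρ) r≢q) c)) (P r c)

-- ∑ c d * ε ^ d * z d over d < K.
horner : ℕ → ℤ → (ℕ → ℤ) → (ℕ → ℤ) → ℤ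
horner zero    ε c z = 0ℤ
horner (suc K) ε c z = c 0 * z 0 + ε * horner K ε (c ∘ suc) (z ∘ suc)

horner-polynomial : ∀ {m} K {ε : Vector ℤ m → ℤ} c {z : ℕ → Vector ℤ m → ℤ} → IsPolynomial ε →
  (∀ d → IsPolynomial (z d)) → IsPolynomial (λ ρ → horner K (ε ρ) c (λ d → z d ρ))
horner-polynomial zero    c E Z = constant 0ℤ
horner-polynomial (suc K) c E Z = (constant (c 0) ⊗ Z 0) ⊕ (E ⊗ horner-polynomial K (c ∘ suc) E (Z ∘ suc))

triangle : ℕ → ℕ
triangle zero    = 0
triangle (suc n) = n ℕ.+ triangle n

disjoint-∷ : ∀ {A : Set} {q : A} {S₁ S₂} → All (q ≢_) S₂ → All (λ r → All (r ≢_) S₁) S₂ →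
             All (λ r → All (r ≢_) (q ∷ S₁)) S₂
disjoint-∷ []           []                = []
disjoint-∷ (q≢r ∷ q∉S₂) (r∉S₁ ∷ disjoint) = ((q≢r ∘ sym) ∷ r∉S₁) ∷ disjoint-∷ q∉S₂ disjoint

module _ {m n : ℕ} (ε : Vector ℤ m → ℤ) (E : IsPolynomial ε) where

  -- The coefficients `c` belong to the row, whereas the vectors `z d` are shared: a determinant
  -- with `z 0` chosen in two rows vanishes.
  HornerRow : ℕ → (ℕ → Vector ℤ m → Vector ℤ n) → (Vector ℤ m → Matrix n n) → Fin n → Set
  HornerRow K z A q = Σ (ℕ → ℤ) λ c → ∀ ρ col → A ρ q col ≡ horner K (ε ρ) c (λ d → z d ρ col)

  HornerRow-minimal : ∀ K (z : ℕ → Vector ℤ m → Vector ℤ n) (A : Vector ℤ m → Matrix n n) {q}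
    (v : Vector ℤ m → Vector ℤ n) {r} → r ≢ q →
    HornerRow K z A r → HornerRow K z (λ ρ → A ρ [ q ≔ v ρ ]) r
  HornerRow-minimal K z A v r≢q (c , eq) = c , λ ρ col →
    trans (cong-app (≔-minimal (A ρ) (v ρ) r≢q) col) (eq ρ col)

  HornerRows-minimal : ∀ K (z : ℕ → Vector ℤ m → Vector ℤ n) (A : Vector ℤ m → Matrix n n) {q}
    (v : Vector ℤ m → Vector ℤ n) {S} → All (q ≢_) S →
    All (HornerRow K z A) S → All (HornerRow K z (λ ρ → A ρ [ q ≔ v ρ ])) S
  HornerRows-minimal K z A v []            []           = []
  HornerRows-minimal K z A v (q≢r ∷ q∉S) (row ∷ rows) =
    HornerRow-minimal K z A v (q≢r ∘ sym) row ∷ HornerRows-minimal K z A v q∉S rows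

  ∣ᴾ-suc : ∀ e {f g : Vector ℤ m → ℤ} → (∀ ρ → f ρ ≡ ε ρ * g ρ) → (λ ρ → ε ρ ^ e) ∣ᴾ g → (λ ρ → ε ρ ^ suc e) ∣ᴾ f
  ∣ᴾ-suc e f≡εg (divides {q} Q g≡) = divides Q λ ρ →
    trans (f≡εg ρ) (trans (cong (ε ρ *_) (g≡ ρ)) (sym (*-assoc (ε ρ) (ε ρ ^ e) (q ρ))))

  ∣ᴾ-weaken : ∀ a {e} {f : Vector ℤ m → ℤ} → (λ ρ → ε ρ ^ (a ℕ.+ e)) ∣ᴾ f → (λ ρ → ε ρ ^ e) ∣ᴾ f
  ∣ᴾ-weaken zero    d = d
  ∣ᴾ-weaken (suc a) {e} (divides {q} Q f≡) = ∣ᴾ-weaken a {e} (divides (E ⊗ Q) λ ρ →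
    trans (f≡ ρ) (xy∙z≈y∙xz (ε ρ) (ε ρ ^ (a ℕ.+ e)) (q ρ)))

  HornerRowsDivisibility : ℕ → Set
  HornerRowsDivisibility K = ∀ z → (∀ d col → IsPolynomial (λ ρ → z d ρ col)) →
    ∀ A → PolynomialMatrix A → ∀ S → Unique S → All (HornerRow K z A) S →
    (λ ρ → ε ρ ^ triangle (length S)) ∣ᴾ (λ ρ → det (A ρ))

  module _ (K : ℕ) (IH : HornerRowsDivisibility K)
           (z : ℕ → Vector ℤ m → Vector ℤ n) (Z : ∀ d col → IsPolynomial (λ ρ → z d ρ col)) where

    private
      tail-row : (ℕ → ℤ) → Vector ℤ m → Vector ℤ n
      tail-row c ρ col = horner K (ε ρ) (c ∘ suc) (λ d → z (suc d) ρ col)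

      tail-row-polynomial : ∀ c col → IsPolynomial (λ ρ → tail-row c ρ col)
      tail-row-polynomial c col = horner-polynomial K (c ∘ suc) E (λ d → Z (suc d) col)

      tail-HornerRow : ∀ (A : Vector ℤ m → Matrix n n) q c → HornerRow K (z ∘ suc) (λ ρ → A ρ [ q ≔ tail-row c ρ ]) q
      tail-HornerRow A q c = c ∘ suc , λ ρ col → cong-app (≔-updates (A ρ) q (tail-row c ρ)) col

    -- Row `p` is `z 0` itself, so the leading term of every row in `S₂` can be removed and a factor
    -- ε extracted. Such a row moves to `S₁`, whose rows start at `z 1`. Once `S₂` is empty, `IH`
    -- supplies the triangular exponent.
    with-leading-row : ∀ A → PolynomialMatrix A → ∀ p → (∀ ρ col → A ρ p col ≡ z 0 ρ col) →
      ∀ S₁ S₂ → Unique S₁ → Unique S₂ → All (λ q → All (q ≢_) S₁) S₂ → All (p ≢_) S₂ →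
      All (HornerRow K (z ∘ suc) A) S₁ → All (HornerRow (suc K) z A) S₂ →
      (λ ρ → ε ρ ^ (length S₂ ℕ.+ triangle (length S₂ ℕ.+ length S₁))) ∣ᴾ (λ ρ → det (A ρ))
    with-leading-row A P p Ap S₁ [] u₁ _ _ _ rows₁ _ = IH (z ∘ suc) (Z ∘ suc) A P S₁ u₁ rows₁
    with-leading-row A P p Ap S₁ (q ∷ S₂) u₁ (q∉S₂ ∷ u₂) (q∉S₁ ∷ disjoint) (p≢q ∷ p∉S₂) rows₁ ((c , Aq) ∷ rows₂) =
      ∣ᴾ-suc (length S₂ ℕ.+ triangle (suc (length S₂ ℕ.+ length S₁))) det≡
        (subst (λ k → (λ ρ → ε ρ ^ (length S₂ ℕ.+ triangle k)) ∣ᴾ (λ ρ → det (A′ ρ)))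
          (ℕ.+-suc (length S₂) (length S₁))
          (with-leading-row A′ (≔-polynomial q P (tail-row-polynomial c)) p
            (λ ρ col → trans (cong-app (≔-minimal (A ρ) (tail-row c ρ) p≢q) col) (Ap ρ col))
            (q ∷ S₁) S₂ (q∉S₁ ∷ u₁) u₂
            (disjoint-∷ q∉S₂ disjoint) p∉S₂
            (tail-HornerRow A q c ∷ HornerRows-minimal K (z ∘ suc) A (tail-row c) q∉S₁ rows₁)
            (HornerRows-minimal (suc K) z A (tail-row c) q∉S₂ rows₂)))
      where
      A′ : Vector ℤ m → Matrix n n
      A′ ρ = A ρ [ q ≔ tail-row c ρ ]
      drop : ∀ x y → x * 0ℤ + y ≡ y
      drop = solve-∀
      det≡ : ∀ ρ → det (A ρ) ≡ ε ρ * det (A′ ρ)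
      det≡ ρ = trans (det-split (A ρ) q (c 0) (ε ρ) (z 0 ρ) (tail-row c ρ) (Aq ρ))
        (trans (cong (λ x → c 0 * x + ε ρ * det (A′ ρ))
          (det-alternating (A ρ [ q ≔ z 0 ρ ]) p q p≢q λ col →
            trans (trans (cong-app (≔-minimal (A ρ) (z 0 ρ) p≢q) col) (Ap ρ col))
              (sym (cong-app (≔-updates (A ρ) q (z 0 ρ)) col))))
          (drop (c 0) (ε ρ * det (A′ ρ))))

    -- Row `q` is split into its leading term and ε times its tail. In the first summand `q` serves
    -- as the leading row for `S₂`; in the second it joins `S₁`, and the next row of `S₂` is split.
    without-leading-row : ∀ A → PolynomialMatrix A →
      ∀ S₁ q S₂ → Unique S₁ → Unique (q ∷ S₂) → All (λ q → All (q ≢_) S₁) (q ∷ S₂) →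
      All (HornerRow K (z ∘ suc) A) S₁ → All (HornerRow (suc K) z A) (q ∷ S₂) →
      (λ ρ → ε ρ ^ (length S₂ ℕ.+ triangle (length S₂ ℕ.+ length S₁))) ∣ᴾ (λ ρ → det (A ρ))
    without-leading-row A P S₁ q S₂ u₁ (q∉S₂ ∷ u₂) (q∉S₁ ∷ disjoint) rows₁ ((c , Aq) ∷ rows₂) =
      ∣ᴾ-respects (λ ρ → sym (det-split (A ρ) q (c 0) (ε ρ) (z 0 ρ) (tail-row c ρ) (Aq ρ)))
        (∣ᴾ-+ (∣ᴾ-multiple (constant (c 0)) first′) (second S₂ q∉S₂ u₂ disjoint rows₂))
      where
      A′ : Vector ℤ m → Matrix n n
      A′ ρ = A ρ [ q ≔ tail-row c ρ ]
      P′ : PolynomialMatrix A′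
      P′ = ≔-polynomial q P (tail-row-polynomial c)
      first′ : (λ ρ → ε ρ ^ (length S₂ ℕ.+ triangle (length S₂ ℕ.+ length S₁))) ∣ᴾ (λ ρ → det (A ρ [ q ≔ z 0 ρ ]))
      first′ = with-leading-row (λ ρ → A ρ [ q ≔ z 0 ρ ]) (≔-polynomial q P (Z 0)) q
        (λ ρ → cong-app (≔-updates (A ρ) q (z 0 ρ))) S₁ S₂ u₁ u₂ disjoint q∉S₂
        (HornerRows-minimal K (z ∘ suc) A (z 0) q∉S₁ rows₁) (HornerRows-minimal (suc K) z A (z 0) q∉S₂ rows₂)
      rows₁′ : All (HornerRow K (z ∘ suc) A′) (q ∷ S₁)
      rows₁′ = tail-HornerRow A q c ∷ HornerRows-minimal K (z ∘ suc) A (tail-row c) q∉S₁ rows₁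
      second : ∀ S₂ → All (q ≢_) S₂ → Unique S₂ → All (λ q → All (q ≢_) S₁) S₂ → All (HornerRow (suc K) z A) S₂ →
        (λ ρ → ε ρ ^ (length S₂ ℕ.+ triangle (length S₂ ℕ.+ length S₁))) ∣ᴾ (λ ρ → ε ρ * det (A′ ρ))
      -- No row has contributed `z 0`. This summand has more factors ε than claimed, and the surplus
      -- is discarded.
      second [] _ _ _ _ = ∣ᴾ-multiple E
        (∣ᴾ-weaken (length S₁) (IH (z ∘ suc) (Z ∘ suc) A′ P′ (q ∷ S₁) (q∉S₁ ∷ u₁) rows₁′))
      second (r ∷ S₂) q∉S₂ u₂ disjoint rows₂ = ∣ᴾ-suc (length S₂ ℕ.+ triangle (suc (length S₂ ℕ.+ length S₁))) (λ ρ → refl)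
        (subst (λ k → (λ ρ → ε ρ ^ (length S₂ ℕ.+ triangle k)) ∣ᴾ (λ ρ → det (A′ ρ)))
          (ℕ.+-suc (length S₂) (length S₁))
          (without-leading-row A′ P′ (q ∷ S₁) r S₂ (q∉S₁ ∷ u₁) u₂
            (disjoint-∷ q∉S₂ disjoint)
            rows₁′ (HornerRows-minimal (suc K) z A (tail-row c) q∉S₂ rows₂)))

  -- Expand det in the rows of S: since z 0 can be chosen in at most one of them, every other
  -- row contributes a factor ε, and the exponents add up to 0 + 1 + … + (length S - 1).
  horner-rows-divisibility : ∀ K → HornerRowsDivisibility K
  horner-rows-divisibility K z Z A P [] _ _ = 1∣ᴾ (det-polynomial P)
  horner-rows-divisibility zero z Z A P (q ∷ S) _ ((c , Aq) ∷ _) = divides (constant 0ℤ) λ ρ →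
    trans (det-zero-row (A ρ) q (Aq ρ)) (sym (*-zeroʳ (ε ρ ^ triangle (suc (length S)))))
  horner-rows-divisibility (suc K) z Z A P (q ∷ S) u rows =
    subst (λ k → (λ ρ → ε ρ ^ (length S ℕ.+ triangle k)) ∣ᴾ (λ ρ → det (A ρ))) (ℕ.+-identityʳ (length S))
      (without-leading-row K (horner-rows-divisibility K) z Z A P [] q S [] u (All.universal (λ _ → []) (q ∷ S)) [] rows)

-- Row spans and simultaneous row replacement

data InSpan {n p} (R : Fin n → Set) (A : Matrix n p) : Vector ℤ p → Set where
  zero  : ∀ {v} → (∀ c → v c ≡ 0ℤ) → InSpan R A v
  -- The vector built so far is scaled as well, which matches one step of `horner`.
  add   : ∀ {v w} q x y → R q → InSpan R A v → (∀ c → w c ≡ x * A q c + y * v c) → InSpan R A w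

InSpan-resp : ∀ {n p} {R : Fin n → Set} {A B : Matrix n p} {v} →
  (∀ q → R q → ∀ c → A q c ≡ B q c) → InSpan R A v → InSpan R B v
InSpan-resp A≡B (zero v≡0)                 = zero v≡0
InSpan-resp A≡B (add {v} q x y r span eq) = add q x y r (InSpan-resp A≡B span)
  λ c → trans (eq c) (cong (λ t → x * t + y * v c) (A≡B q r c))

-- By linearity in row `q`, every term repeats a row that still stands elsewhere in the matrix.
det-InSpan : ∀ {n} {R : Fin n → Set} (A : Matrix n n) q → (∀ {r} → R r → r ≢ q) →
  ∀ {v} → InSpan R A v → det (A [ q ≔ v ]) ≡ 0ℤ
det-InSpan A q R≢q {v} (zero v≡0) = det-zero-row (A [ q ≔ v ]) q
  λ c → trans (cong-app (≔-updates A q v) c) (v≡0 c)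
det-InSpan A q R≢q (add {v} r x y Rr span eq) = trans (det-≔-cong A q eq)
  (trans (det-≔-linear A q x y (A r) v)
    (trans (cong₂ (λ s t → x * s + y * t)
        (det-alternating (A [ q ≔ A r ]) r q (R≢q Rr) λ c →
          trans (cong-app (≔-minimal A (A r) (R≢q Rr)) c) (sym (cong-app (≔-updates A q (A r)) c)))
        (det-InSpan A q R≢q span))
      (zeroes x y)))
  where
  zeroes : ∀ x y → x * 0ℤ + y * 0ℤ ≡ 0ℤ
  zeroes = solve-∀

module _ {n k : ℕ} (row : Fin k → Fin n) (row-injective : ∀ {i j} → row i ≡ row j → i ≡ j) where

  replaceRows : ∀ {p} → List (Fin k) → Matrix k p → Matrix n p → Matrix n p
  replaceRows []      U A = A
  replaceRows (i ∷ S) U A = replaceRows S U (A [ row i ≔ U i ])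

  replaceRows-minimal : ∀ {p} S (U : Matrix k p) A {r} → All (λ i → r ≢ row i) S →
    ∀ c → replaceRows S U A r c ≡ A r c
  replaceRows-minimal []      U A []            c = refl
  replaceRows-minimal (i ∷ S) U A (r≢i ∷ r∉S) c =
    trans (replaceRows-minimal S U (A [ row i ≔ U i ]) r∉S c) (cong-app (≔-minimal A (U i) r≢i) c)

  replaceRows-updates : ∀ {p} S (U : Matrix k p) A → Unique S →
    All (λ i → ∀ c → replaceRows S U A (row i) c ≡ U i c) S
  replaceRows-updates []      U A []         = []
  replaceRows-updates (i ∷ S) U A (i∉S ∷ u) =
    (λ c → trans (replaceRows-minimal S U (A [ row i ≔ U i ]) (All.map (_∘ row-injective) i∉S) c)
      (cong-app (≔-updates A (row i) (U i)) c))
    ∷ replaceRows-updates S U (A [ row i ≔ U i ]) u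

  replaceRows-polynomial : ∀ {m p} S {U : Vector ℤ m → Matrix k p} {A : Vector ℤ m → Matrix n p} →
    PolynomialMatrix U → PolynomialMatrix A → PolynomialMatrix (λ ρ → replaceRows S (U ρ) (A ρ))
  replaceRows-polynomial []      PU PA = PA
  replaceRows-polynomial (i ∷ S) PU PA = replaceRows-polynomial S PU (≔-polynomial (row i) PA (PU i))

  -- Row by row, `d i` is multiplied in, the part `V i` is dropped, and ε ^ e i is extracted. The
  -- span uses only rows outside the image of `row`, so earlier replacements do not disturb it.
  det-replaceRows : ∀ (ε : ℤ) (d : Vector ℤ k) (e : Vector ℕ k) (U V : Matrix k n) →
    ∀ S (A : Matrix n n) → Unique S →
    (∀ i → InSpan (λ r → ∀ j → r ≢ row j) A (V i)) →
    All (λ i → ∀ c → d i * A (row i) c ≡ V i c + ε ^ e i * U i c) S →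
    foldr _*_ 1ℤ (map d S) * det A ≡ ε ^ sum (map e S) * det (replaceRows S U A)
  det-replaceRows ε d e U V []      A _ _ _ = refl
  det-replaceRows ε d e U V (i ∷ S) A (i∉S ∷ u) span (eq ∷ eqs) = begin
    d i * ∏d * det A              ≡⟨ xy∙z≈y∙xz (d i) ∏d (det A) ⟩
    ∏d * (d i * det A)            ≡⟨ cong (∏d *_) step ⟩
    ∏d * (ε ^ e i * det A′)       ≡⟨ x∙yz≈y∙xz ∏d (ε ^ e i) (det A′) ⟩
    ε ^ e i * (∏d * det A′)       ≡⟨ cong (ε ^ e i *_) (det-replaceRows ε d e U V S A′ u span′ eqs′) ⟩
    ε ^ e i * (ε ^ sum (map e S) * X)  ≡⟨ sym (*-assoc (ε ^ e i) (ε ^ sum (map e S)) X) ⟩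
    ε ^ e i * ε ^ sum (map e S) * X    ≡⟨ cong (_* X) (sym (^-distribˡ-+-* ε (e i) (sum (map e S)))) ⟩
    ε ^ (e i ℕ.+ sum (map e S)) * X    ∎
    where
    open ≡-Reasoning
    A′ : Matrix n n
    A′ = A [ row i ≔ U i ]
    ∏d X : ℤ
    ∏d = foldr _*_ 1ℤ (map d S)
    X = det (replaceRows S U A′)
    one : ∀ x y → x + y ≡ 1ℤ * x + y
    one = solve-∀
    drop : ∀ x → 1ℤ * 0ℤ + x ≡ x
    drop = solve-∀
    drop′ : ∀ x y → x ≡ x + 0ℤ * y
    drop′ = solve-∀
    step : d i * det A ≡ ε ^ e i * det A′
    step = begin
      d i * det A
        -- A summand with coefficient 0 brings the scaling of one row into the two-term form of
        -- `det-≔-linear`.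
        ≡⟨ drop′ _ (det (A [ row i ≔ V i ])) ⟩
      d i * det A + 0ℤ * det (A [ row i ≔ V i ])
        ≡⟨ cong (λ t → d i * t + 0ℤ * det (A [ row i ≔ V i ])) (sym (det-≔-self A (row i))) ⟩
      d i * det (A [ row i ≔ A (row i) ]) + 0ℤ * det (A [ row i ≔ V i ])
        ≡⟨ sym (det-≔-linear A (row i) (d i) 0ℤ (A (row i)) (V i)) ⟩
      det (A [ row i ≔ (λ c → d i * A (row i) c + 0ℤ * V i c) ])
        ≡⟨ det-≔-cong A (row i) (λ c → trans (sym (drop′ _ (V i c))) (trans (eq c) (one (V i c) (ε ^ e i * U i c)))) ⟩
      det (A [ row i ≔ (λ c → 1ℤ * V i c + ε ^ e i * U i c) ])
        ≡⟨ det-≔-linear A (row i) 1ℤ (ε ^ e i) (V i) (U i) ⟩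
      1ℤ * det (A [ row i ≔ V i ]) + ε ^ e i * det A′
        ≡⟨ cong (λ t → 1ℤ * t + ε ^ e i * det A′) (det-InSpan A (row i) (λ r∉ → r∉ i) (span i)) ⟩
      1ℤ * 0ℤ + ε ^ e i * det A′
        ≡⟨ drop _ ⟩
      ε ^ e i * det A′ ∎
    span′ : ∀ j → InSpan (λ r → ∀ j → r ≢ row j) A′ (V j)
    span′ j = InSpan-resp (λ r r∉ c → sym (cong-app (≔-minimal A (U i) (r∉ i)) c)) (span j)
    eqs′ : All (λ j → ∀ c → d j * A′ (row j) c ≡ V j c + ε ^ e j * U j c) S
    eqs′ = All.zipWith
      (λ {j} (i≢j , eq) c → trans (cong (d j *_) (cong-app (≔-minimal A (U i) (i≢j ∘ sym ∘ row-injective)) c)) (eq c))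
      (i∉S , eqs)

-- Taylor expansion

-- Whole products are compared, because a vanishing coefficient may hide different vectors, as
-- happens in `taylor` beyond order n.
horner-cong : ∀ K ε c c′ z z′ → (∀ d → d < K → c d * z d ≡ c′ d * z′ d) → horner K ε c z ≡ horner K ε c′ z′
horner-cong zero    ε c c′ z z′ eq = refl
horner-cong (suc K) ε c c′ z z′ eq = cong₂ (λ x y → x + ε * y) (eq 0 (ℕ.s≤s ℕ.z≤n))
  (horner-cong K ε (c ∘ suc) (c′ ∘ suc) (z ∘ suc) (z′ ∘ suc) λ d d<K → eq (suc d) (ℕ.s≤s d<K))

horner-zero : ∀ K ε c z → (∀ d → c d ≡ 0ℤ) → horner K ε c z ≡ 0ℤ
horner-zero zero    ε c z c≡0 = refl
horner-zero (suc K) ε c z c≡0 =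
  trans (cong₂ (λ x y → x * z 0 + ε * y) (c≡0 0) (horner-zero K ε (c ∘ suc) (z ∘ suc) (c≡0 ∘ suc)))
    (cong (λ t → 0ℤ + t) (*-zeroʳ ε))

horner-linear : ∀ K ε x c y z → horner K ε c (λ d → x * y d + z d) ≡ x * horner K ε c y + horner K ε c z
horner-linear zero    ε x c y z = zeroes x
  where
  zeroes : ∀ x → 0ℤ ≡ x * 0ℤ + 0ℤ
  zeroes = solve-∀
horner-linear (suc K) ε x c y z =
  trans (cong (λ t → c 0 * (x * y 0 + z 0) + ε * t) (horner-linear K ε x (c ∘ suc) (y ∘ suc) (z ∘ suc)))
    (rearrange (c 0) x (y 0) (z 0) ε (horner K ε (c ∘ suc) (y ∘ suc)) (horner K ε (c ∘ suc) (z ∘ suc)))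
  where
  rearrange : ∀ c x y z ε h k → c * (x * y + z) + ε * (x * h + k) ≡ x * (c * y + ε * h) + (c * z + ε * k)
  rearrange = solve-∀

horner-+ : ∀ K ε c c′ z → horner K ε (λ d → c d + c′ d) z ≡ horner K ε c z + horner K ε c′ z
horner-+ zero    ε c c′ z = refl
horner-+ (suc K) ε c c′ z =
  trans (cong (λ t → (c 0 + c′ 0) * z 0 + ε * t) (horner-+ K ε (c ∘ suc) (c′ ∘ suc) (z ∘ suc)))
    (rearrange (c 0) (c′ 0) (z 0) ε (horner K ε (c ∘ suc) (z ∘ suc)) (horner K ε (c′ ∘ suc) (z ∘ suc)))
  where
  rearrange : ∀ c c′ z ε h k → (c + c′) * z + ε * (h + k) ≡ (c * z + ε * h) + (c′ * z + ε * k)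
  rearrange = solve-∀

horner-split : ∀ p K ε c z →
  horner (p ℕ.+ K) ε c z ≡ horner p ε c z + ε ^ p * horner K ε (λ d → c (p ℕ.+ d)) (λ d → z (p ℕ.+ d))
horner-split zero    K ε c z = one (horner K ε c z)
  where
  one : ∀ x → x ≡ 0ℤ + 1ℤ * x
  one = solve-∀
horner-split (suc p) K ε c z =
  trans (cong (λ t → c 0 * z 0 + ε * t) (horner-split p K ε (c ∘ suc) (z ∘ suc)))
    (rearrange (c 0 * z 0) ε (horner p ε (c ∘ suc) (z ∘ suc)) (ε ^ p) _)
  where
  rearrange : ∀ a ε h e k → a + ε * (h + e * k) ≡ a + ε * h + ε * e * k
  rearrange = solve-∀

-- The h-th divided derivative of xⁿ.
divided : ℕ → ℕ → ℤ → ℤ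
divided n h x = + (n C h) * x ^ (n ∸ h)

divided-pred : ℕ → ℕ → ℤ → ℤ
divided-pred n zero    x = 0ℤ
divided-pred n (suc h) x = divided n h x

-- The Leibniz rule for x * x ^ n, with the derivative of order -1 read as 0. On coefficients it is
-- Pascal's rule.
divided-suc : ∀ n h x → divided (suc n) h x ≡ x * divided n h x + divided-pred n h x
divided-suc n zero x = eq x (x ^ n)
  where
  eq : ∀ x y → 1ℤ * (x * y) ≡ x * (1ℤ * y) + 0ℤ
  eq = solve-∀
divided-suc n (suc h) x with h ℕ.<? n
... | yes h<n = begin
  + (suc n C suc h) * x ^ (n ∸ h)
    ≡⟨ cong (λ t → + t * x ^ (n ∸ h)) (sym (nCk+nC[k+1]≡[n+1]C[k+1] n h)) ⟩
  + (n C h ℕ.+ n C suc h) * x ^ (n ∸ h)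
    ≡⟨ cong (_* x ^ (n ∸ h)) (pos-+ (n C h) (n C suc h)) ⟩
  (+ (n C h) + + (n C suc h)) * x ^ (n ∸ h)
    ≡⟨ cong (λ e → (+ (n C h) + + (n C suc h)) * x ^ e) n∸h ⟩
  (+ (n C h) + + (n C suc h)) * (x * x ^ (n ∸ suc h))
    ≡⟨ eq (+ (n C h)) (+ (n C suc h)) x (x ^ (n ∸ suc h)) ⟩
  x * (+ (n C suc h) * x ^ (n ∸ suc h)) + + (n C h) * (x * x ^ (n ∸ suc h))
    ≡⟨ cong (λ e → x * (+ (n C suc h) * x ^ (n ∸ suc h)) + + (n C h) * x ^ e) (sym n∸h) ⟩
  x * (+ (n C suc h) * x ^ (n ∸ suc h)) + + (n C h) * x ^ (n ∸ h) ∎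
  where
  open ≡-Reasoning
  n∸h : n ∸ h ≡ suc (n ∸ suc h)
  n∸h = ℕ.+-∸-assoc 1 h<n
  eq : ∀ a b x y → (a + b) * (x * y) ≡ x * (b * y) + a * (x * y)
  eq = solve-∀
-- For h ≥ n the truncated exponents violate `n∸h`, but n C (h + 1) = 0 removes the term concerned.
... | no h≮n = trans
  (cong (λ t → + t * x ^ (n ∸ h)) (trans (sym (nCk+nC[k+1]≡[n+1]C[k+1] n h))
    (trans (cong (n C h ℕ.+_) nC[h+1]≡0) (ℕ.+-identityʳ (n C h)))))
  (trans (eq x (x ^ (n ∸ suc h)) (+ (n C h) * x ^ (n ∸ h)))
    (cong (λ t → x * (+ t * x ^ (n ∸ suc h)) + + (n C h) * x ^ (n ∸ h)) (sym nC[h+1]≡0)))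
  where
  nC[h+1]≡0 : n C suc h ≡ 0
  nC[h+1]≡0 = k>n⇒nCk≡0 (ℕ.s≤s (ℕ.≮⇒≥ h≮n))
  eq : ∀ x y z → z ≡ x * (0ℤ * y) + z
  eq = solve-∀

-- This is the h-th divided derivative, with respect to a, of the binomial expansion of (a + ε) ^ n.
-- The induction on n combines Pascal's rule for the coefficients with the Leibniz rule for the
-- powers. The length `K` is free above n because the step uses two consecutive lengths.
taylor : ∀ n h K a ε → n < K →
  horner K ε (λ e → + (n C e)) (λ e → divided (n ∸ e) h a) ≡ divided n h (a + ε)
taylor zero h (suc K) a ε _ = begin
  1ℤ * divided 0 h a + ε * horner K ε (λ e → + (0 C suc e)) (λ e → divided 0 h a)
    ≡⟨ cong (λ t → 1ℤ * divided 0 h a + ε * t) (horner-zero K ε (λ e → + (0 C suc e)) (λ e → divided 0 h a) (λ d → refl)) ⟩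
  1ℤ * (+ (0 C h) * a ^ (0 ∸ h)) + ε * 0ℤ
    ≡⟨ eq (+ (0 C h) * a ^ (0 ∸ h)) ε ⟩
  + (0 C h) * a ^ (0 ∸ h)
    ≡⟨ cong (λ e → + (0 C h) * a ^ e) (ℕ.0∸n≡0 h) ⟩
  + (0 C h) * 1ℤ
    ≡⟨ cong (λ e → + (0 C h) * (a + ε) ^ e) (sym (ℕ.0∸n≡0 h)) ⟩
  + (0 C h) * (a + ε) ^ (0 ∸ h) ∎
  where
  open ≡-Reasoning
  eq : ∀ x ε → 1ℤ * x + ε * 0ℤ ≡ x
  eq = solve-∀
taylor (suc n) h (suc K) a ε (ℕ.s≤s n<K) = begin
  + (suc n C 0) * z 0 + ε * horner K ε (λ e → + (suc n C suc e)) (z ∘ suc)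
    ≡⟨ cong (λ t → 1ℤ * z 0 + ε * t) pascal ⟩
  1ℤ * z 0 + ε * (horner K ε c (z ∘ suc) + horner K ε (c ∘ suc) (z ∘ suc))
    ≡⟨ regroup (1ℤ * z 0) ε (horner K ε c (z ∘ suc)) (horner K ε (c ∘ suc) (z ∘ suc)) ⟩
  horner (suc K) ε c z + ε * horner K ε c (z ∘ suc)
    ≡⟨ cong₂ (λ s t → s + ε * t) lower (taylor n h K a ε n<K) ⟩
  (a * divided n h (a + ε) + divided-pred n h (a + ε)) + ε * divided n h (a + ε)
    ≡⟨ collect a ε (divided n h (a + ε)) (divided-pred n h (a + ε)) ⟩
  (a + ε) * divided n h (a + ε) + divided-pred n h (a + ε)
    ≡⟨ sym (divided-suc n h (a + ε)) ⟩
  divided (suc n) h (a + ε) ∎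
  where
  open ≡-Reasoning
  c : ℕ → ℤ
  c e = + (n C e)
  z : ℕ → ℤ
  z e = divided (suc n ∸ e) h a
  regroup : ∀ s ε p q → s + ε * (p + q) ≡ (s + ε * q) + ε * p
  regroup = solve-∀
  collect : ∀ a ε x y → (a * x + y) + ε * x ≡ (a + ε) * x + y
  collect = solve-∀
  pascal : horner K ε (λ e → + (suc n C suc e)) (z ∘ suc) ≡ horner K ε c (z ∘ suc) + horner K ε (c ∘ suc) (z ∘ suc)
  pascal = trans
    (horner-cong K ε (λ e → + (suc n C suc e)) (λ e → c e + c (suc e)) (z ∘ suc) (z ∘ suc) λ e _ →
      cong (_* z (suc e)) (trans (cong +_ (sym (nCk+nC[k+1]≡[n+1]C[k+1] n e))) (pos-+ (n C e) (n C suc e))))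
    (horner-+ K ε c (c ∘ suc) (z ∘ suc))
  term : ∀ e → c e * z e ≡ c e * (a * divided (n ∸ e) h a + divided-pred (n ∸ e) h a)
  term e with e ℕ.≤? n
  ... | yes e≤n = cong (c e *_) (trans (cong (λ k → divided k h a) (ℕ.+-∸-assoc 1 e≤n)) (divided-suc (n ∸ e) h a))
  -- Here truncated subtraction invalidates the Leibniz step, but the coefficient n C e is 0.
  ... | no e≰n rewrite k>n⇒nCk≡0 (ℕ.≰⇒> e≰n) = refl
  pred : ∀ h → horner (suc K) ε c (λ e → divided-pred (n ∸ e) h a) ≡ divided-pred n h (a + ε)
  pred zero = trans (horner-cong (suc K) ε c (λ _ → 0ℤ) (λ _ → 0ℤ) (λ _ → 0ℤ) (λ e _ → *-zeroʳ (c e)))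
    (horner-zero (suc K) ε (λ _ → 0ℤ) (λ _ → 0ℤ) (λ _ → refl))
  pred (suc h) = taylor n h (suc K) a ε (ℕ.m<n⇒m<1+n n<K)
  lower : horner (suc K) ε c z ≡ a * divided n h (a + ε) + divided-pred n h (a + ε)
  lower = trans (horner-cong (suc K) ε c c z _ (λ e _ → term e))
    (trans (horner-linear (suc K) ε a c (λ e → divided (n ∸ e) h a) (λ e → divided-pred (n ∸ e) h a))
      (cong₂ (λ s t → a * s + t) (taylor n h (suc K) a ε (ℕ.m<n⇒m<1+n n<K)) (pred h)))

kronecker : ℕ → ℕ → ℤ
kronecker zero    zero    = 1ℤ
kronecker zero    (suc d) = 0ℤ
kronecker (suc s) zero    = 0ℤ
kronecker (suc s) (suc d) = kronecker s d

-- Turns a monomial into a Horner sum with constant vectors, so that a row of monomials of varying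
-- degree becomes a `HornerRow`.
horner-kronecker : ∀ K ε c s → s < K → horner K ε c (kronecker s) ≡ c s * ε ^ s
horner-kronecker (suc K) ε c zero _ =
  trans (cong (λ t → c 0 * 1ℤ + ε * t)
    (trans (horner-cong K ε (c ∘ suc) (λ _ → 0ℤ) (λ _ → 0ℤ) (λ _ → 0ℤ) (λ d _ → *-zeroʳ (c (suc d))))
      (horner-zero K ε (λ _ → 0ℤ) (λ _ → 0ℤ) (λ _ → refl))))
    (eq (c 0) ε)
  where
  eq : ∀ c ε → c * 1ℤ + ε * 0ℤ ≡ c * 1ℤ
  eq = solve-∀
horner-kronecker (suc K) ε c (suc s) (ℕ.s≤s s<K) =
  trans (cong (λ t → c 0 * 0ℤ + ε * t) (horner-kronecker K ε (c ∘ suc) s s<K))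
    (eq (c 0) ε (c (suc s)) (ε ^ s))
  where
  eq : ∀ c ε d e → c * 0ℤ + ε * (d * e) ≡ d * (ε * e)
  eq = solve-∀

-- Powers of linear forms dividing the minors

blockRow : ∀ {m} (ν : Vector ℕ m) (j : Fin m) → Fin (ν j) → Fin (sumℕ ν)
blockRow {suc m} ν zero    i = i ↑ˡ sumℕ (tail ν)
blockRow {suc m} ν (suc j) i = ν zero ↑ʳ blockRow (tail ν) j i

blockRow-injective : ∀ {m} (ν : Vector ℕ m) j {i i′} → blockRow ν j i ≡ blockRow ν j i′ → i ≡ i′
blockRow-injective {suc m} ν zero    eq = Fin.↑ˡ-injective (sumℕ (tail ν)) _ _ eq
blockRow-injective {suc m} ν (suc j) eq = blockRow-injective (tail ν) j (Fin.↑ʳ-injective (ν zero) _ _ eq)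

rowIndex-blockRow : ∀ {m} (ν : Vector ℕ m) j i → rowIndex ν (blockRow ν j i) ≡ (j , i)
rowIndex-blockRow {suc m} ν zero i rewrite Fin.splitAt-↑ˡ (ν zero) i (sumℕ (tail ν)) = refl
rowIndex-blockRow {suc m} ν (suc j) i
  rewrite Fin.splitAt-↑ʳ (ν zero) (sumℕ (tail ν)) (blockRow (tail ν) j i)
        | rowIndex-blockRow (tail ν) j i = refl

blockRow-disjoint : ∀ {m} (ν : Vector ℕ m) {j k} → j ≢ k → ∀ {i i′} → blockRow ν j i ≢ blockRow ν k i′
blockRow-disjoint ν {j} {k} j≢k {i} {i′} eq = j≢k (trans (sym (cong proj₁ (rowIndex-blockRow ν j i)))
  (trans (cong (proj₁ ∘ rowIndex ν) eq) (cong proj₁ (rowIndex-blockRow ν k i′))))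

triangle≡nC2 : ∀ n → triangle n ≡ n C 2
triangle≡nC2 zero    = refl
triangle≡nC2 (suc n) = trans (cong₂ ℕ._+_ (sym (nC1≡n n)) (triangle≡nC2 n)) (nCk+nC[k+1]≡[n+1]C[k+1] n 1)

sum-arithmetic : ∀ k n → sum (tabulate {n = n} (λ i → k ℕ.+ toℕ i)) ≡ n ℕ.* k ℕ.+ triangle n
sum-arithmetic k zero    = refl
sum-arithmetic k (suc n) = trans
  (cong₂ (λ a t → a ℕ.+ t) (ℕ.+-identityʳ k) (trans
    (cong sum (tabulate-cong {n = n} λ i → ℕ.+-suc k (toℕ i)))
    (sum-arithmetic (suc k) n)))
  (rearrange k n (triangle n))
  where
  rearrange : ∀ k n t → k ℕ.+ (n ℕ.* suc k ℕ.+ t) ≡ (k ℕ.+ n ℕ.* k) ℕ.+ (n ℕ.+ t)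
  rearrange = solveℕ-∀

-- The exponent count for a difference: `n ℕ.* 1 ℕ.+ triangle n` is 1 + ... + n, from the factors ε
-- ^ (i + 1), and the second triangle comes from the Horner rows.
triangles-square : ∀ n → n ℕ.* 1 ℕ.+ triangle n ℕ.+ triangle n ≡ n ℕ.^ 2
triangles-square zero    = refl
triangles-square (suc n) = trans (left n (triangle n)) (trans (cong (λ t → t ℕ.+ 2 ℕ.* n ℕ.+ 1) (triangles-square n)) (right n))
  where
  left : ∀ n t → suc n ℕ.* 1 ℕ.+ (n ℕ.+ t) ℕ.+ (n ℕ.+ t) ≡ (n ℕ.* 1 ℕ.+ t ℕ.+ t) ℕ.+ 2 ℕ.* n ℕ.+ 1
  left = solveℕ-∀
  right : ∀ n → n ℕ.* (n ℕ.* 1) ℕ.+ 2 ℕ.* n ℕ.+ 1 ≡ suc n ℕ.* (suc n ℕ.* 1)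
  right = solveℕ-∀

InSpan-horner : ∀ {n p} {R : Fin n → Set} {A : Matrix n p} K ε c (z : ℕ → Vector ℤ p) →
  (∀ d → d < K → Σ ℤ λ x → Σ (Fin n) λ q → Σ (R q) λ _ → ∀ col → z d col ≡ x * A q col) →
  InSpan R A (λ col → horner K ε c (λ d → z d col))
InSpan-horner zero    ε c z multiples = zero (λ _ → refl)
InSpan-horner {A = A} (suc K) ε c z multiples with multiples 0 (ℕ.s≤s ℕ.z≤n)
... | x , q , Rq , z₀≡ = add q (c 0 * x) ε Rq
  (InSpan-horner K ε (c ∘ suc) (z ∘ suc) (λ d d<K → multiples (suc d) (ℕ.s≤s d<K)))
  λ col → cong (_+ ε * horner K ε (c ∘ suc) (λ d → z (suc d) col))
    (trans (cong (c 0 *_) (z₀≡ col)) (sym (*-assoc (c 0) x (A q col))))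

power≢0 : ∀ {x} e → x ≢ 0ℤ → x ^ e ≢ 0ℤ
power≢0 zero    x≢0 ()
power≢0 {x} (suc e) x≢0 eq = [ x≢0 , power≢0 e x≢0 ]′ (i*j≡0⇒i≡0∨j≡0 x eq)

-- A point with positive, pairwise distinct coordinates. It witnesses that the linear forms x_j and
-- x_i - x_j are nonzero, also after a substitution modulo another such form.
generic : ∀ {m} → Vector ℤ m
generic i = + suc (toℕ i)

generic-injective : ∀ {m} {i j : Fin m} → generic i ≡ generic j → i ≡ j
generic-injective eq = Fin.toℕ-injective (ℕ.suc-injective (+-injective eq))

difference≢0 : ∀ {x y} → x ≢ y → x - y ≢ 0ℤ
difference≢0 {x} {y} x≢y eq = x≢y (i-j≡0⇒i≡j x y eq)

difference-power-coprime : ∀ {m} (p q : Fin m) → p ≢ q → ∀ {g} → IsPolynomial g →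
  g (eliminate p (coordinate q) generic) ≢ 0ℤ → ∀ e → g CoprimeTo (λ ρ → (ρ p - ρ q) ^ e)
difference-power-coprime p q p≢q {g} G gv≢0 = power-coprime {ℓ = λ ρ → ρ p - ρ q} {generic} G
  (coordinate p ⊖ coordinate q) (difference≢0 (p≢q ∘ generic-injective))
  (linear-coprime p (coordinate q) (λ ρ → updateAt-minimal q p ρ (p≢q ∘ sym)) {v = generic} G gv≢0)

module _ {m} (ν : Vector ℕ m) (L : ℕ) (γ : Fin (sumℕ ν) → Fin (suc L)) where

  selected : Vector ℤ m → Matrix (sumℕ ν) (sumℕ ν)
  selected ρ r c = 𝒱-entry L {ν} ρ (rowIndex ν r) (γ c)

  selected-polynomial : PolynomialMatrix selected
  selected-polynomial r c with rowIndex ν r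
  ... | j , i = constant (+ ((L ℕ.+ suc (toℕ i)) C toℕ (γ c))) ⊗ power (coordinate j) (L ∸ toℕ (γ c))

  private
    deg : Fin (sumℕ ν) → ℕ
    deg c = toℕ (γ c)

    deg≤L : ∀ c → deg c ≤ L
    deg≤L c = ℕ.s≤s⁻¹ (Fin.toℕ<n (γ c))

  selected-blockRow : ∀ ρ j i c → selected ρ (blockRow ν j i) c ≡ + ((L ℕ.+ suc (toℕ i)) C deg c) * ρ j ^ (L ∸ deg c)
  selected-blockRow ρ j i c = cong (λ r → 𝒱-entry L {ν} ρ r (γ c)) (rowIndex-blockRow ν j i)

  -- The factor ρ j ^ (i + 1) raises the exponent L - h to L + i + 1 - h, as a divided derivative of
  -- order h requires. The subtractions are exact because h ≤ L.
  selected-multiple : ∀ ρ j i c → divided (L ℕ.+ suc (toℕ i)) (deg c) (ρ j) ≡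
                      ρ j ^ suc (toℕ i) * selected ρ (blockRow ν j i) c
  selected-multiple ρ j i c = trans
    (cong (λ e → + ((L ℕ.+ suc (toℕ i)) C deg c) * ρ j ^ e) exponent)
    (trans (cong (+ ((L ℕ.+ suc (toℕ i)) C deg c) *_) (^-distribˡ-+-* (ρ j) (suc (toℕ i)) (L ∸ deg c)))
      (trans (x∙yz≈y∙xz (+ ((L ℕ.+ suc (toℕ i)) C deg c)) (ρ j ^ suc (toℕ i)) (ρ j ^ (L ∸ deg c)))
        (cong (ρ j ^ suc (toℕ i) *_) (sym (selected-blockRow ρ j i c)))))
    where
    exponent : (L ℕ.+ suc (toℕ i)) ∸ deg c ≡ suc (toℕ i) ℕ.+ (L ∸ deg c)
    exponent = trans (cong (_∸ deg c) (ℕ.+-comm L (suc (toℕ i)))) (ℕ.+-∸-assoc (suc (toℕ i)) (deg≤L c))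

  -- The power of x_j in an entry depends only on the column. Thus `z d` can be the indicator of the
  -- columns where this power is d, and the binomials are the coefficients.
  coordinate-power-divides : ∀ j → (λ ρ → ρ j ^ triangle (ν j)) ∣ᴾ (λ ρ → det (selected ρ))
  coordinate-power-divides j =
    subst (λ n → (λ ρ → ρ j ^ triangle n) ∣ᴾ (λ ρ → det (selected ρ)))
      (trans (length-map (blockRow ν j) (allFin (ν j))) (length-tabulate {n = ν j} id))
      (horner-rows-divisibility (λ ρ → ρ j) (coordinate j) (suc L) (λ d ρ c → kronecker (L ∸ deg c) d)
        (λ d c → constant _) selected selected-polynomial (map (blockRow ν j) (allFin (ν j)))
        (Unique.map⁺ (blockRow-injective ν j) (Unique.allFin⁺ (ν j)))
        (All.map⁺ (All.universal row (allFin (ν j)))))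
    where
    row : ∀ i → HornerRow (λ ρ → ρ j) (coordinate j) (suc L) (λ d ρ c → kronecker (L ∸ deg c) d) selected (blockRow ν j i)
    row i = coefficient , λ ρ c → trans (selected-blockRow ρ j i c)
      (trans (cong (λ h → + ((L ℕ.+ suc (toℕ i)) C h) * ρ j ^ (L ∸ deg c)) (sym (ℕ.m∸[m∸n]≡n (deg≤L c))))
        (sym (horner-kronecker (suc L) (ρ j) coefficient (L ∸ deg c) (ℕ.s≤s (ℕ.m∸n≤m L (deg c))))))
      where
      coefficient : ℕ → ℤ
      -- The column index h is recovered from its power d = L - h as L - d.
      coefficient d = + ((L ℕ.+ suc (toℕ i)) C (L ∸ d))

  -- Multiplied by ρ p ^ (i + 1), row i of block p consists of divided derivatives at ρ p. In their
  -- Taylor expansions at ρ q, the terms of order at most i are multiples of rows of block q,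
  -- which det ignores; the remaining ones have the common factor ε ^ (i + 1).
  difference-power-divides : ∀ {p q} → p ≢ q → ν p ≤ ν q →
    (λ ρ → (ρ p - ρ q) ^ (ν p ℕ.^ 2)) ∣ᴾ (λ ρ → det (selected ρ))
  difference-power-divides {p} {q} p≢q νp≤νq =
    -- The divisibility is proved for `scale ρ * det (selected ρ)`. The product of powers of x_p is
    -- then cancelled, since x_p = x_q does not make it vanish.
    difference-power-coprime p q p≢q scale-polynomial scale≢0 (ν p ℕ.^ 2) .cancel (det-polynomial selected-polynomial)
      (combine (horner-rows-divisibility ε E (suc L) z Z cleared
        (replaceRows-polynomial row (blockRow-injective ν p) S U-polynomial selected-polynomial)
        (map row S) (Unique.map⁺ (blockRow-injective ν p) S-unique)
        (All.map⁺ (All.universal cleared-row S))))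
    where
    S : List (Fin (ν p))
    S = allFin (ν p)
    S-unique : Unique S
    S-unique = Unique.allFin⁺ (ν p)
    row : Fin (ν p) → Fin (sumℕ ν)
    row = blockRow ν p
    ε : Vector ℤ m → ℤ
    ε ρ = ρ p - ρ q
    E : IsPolynomial ε
    E = coordinate p ⊖ coordinate q
    exponent : Fin (ν p) → ℕ
    exponent i = suc (toℕ i)
    scale : Vector ℤ m → ℤ
    scale ρ = foldr _*_ 1ℤ (map (λ i → ρ p ^ exponent i) S)
    c : Fin (ν p) → ℕ → ℤ
    c i e = + ((L ℕ.+ exponent i) C e)
    -- The term of order i + 1 + d in the expansion of x ^ (L + i + 1) contains x ^ (L - d), which
    -- is independent of i. This makes the vectors common to all rows of the block.
    z : ℕ → Vector ℤ m → Vector ℤ (sumℕ ν)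
    z d ρ col = divided (L ∸ d) (deg col) (ρ q)
    Z : ∀ d col → IsPolynomial (λ ρ → z d ρ col)
    Z d col = constant (+ ((L ∸ d) C deg col)) ⊗ power (coordinate q) (L ∸ d ∸ deg col)
    c′ : Fin (ν p) → ℕ → ℤ
    c′ i d = c i (exponent i ℕ.+ d)
    V U : Vector ℤ m → Matrix (ν p) (sumℕ ν)
    V ρ i col = horner (exponent i) (ε ρ) (c i) (λ e → divided (L ℕ.+ exponent i ∸ e) (deg col) (ρ q))
    U ρ i col = horner (suc L) (ε ρ) (c′ i) (λ d → z d ρ col)
    U-polynomial : PolynomialMatrix U
    U-polynomial i col = horner-polynomial (suc L) (c′ i) E (λ d → Z d col)
    cleared : Vector ℤ m → Matrix (sumℕ ν) (sumℕ ν)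
    cleared ρ = replaceRows row (blockRow-injective ν p) S (U ρ) (selected ρ)
    cleared-row : ∀ i → HornerRow ε E (suc L) z cleared (row i)
    cleared-row i = c′ i , λ ρ col →
      All.lookup (replaceRows-updates row (blockRow-injective ν p) S (U ρ) (selected ρ) S-unique) (∈-allFin i) col
    expansion : ∀ ρ i col → ρ p ^ exponent i * selected ρ (row i) col ≡ V ρ i col + ε ρ ^ exponent i * U ρ i col
    expansion ρ i col = begin
      ρ p ^ exponent i * selected ρ (row i) col
        ≡⟨ sym (selected-multiple ρ p i col) ⟩
      divided n (deg col) (ρ p)
        ≡⟨ cong (divided n (deg col)) (sym (shift (ρ p) (ρ q))) ⟩
      divided n (deg col) (ρ q + ε ρ)
        ≡⟨ sym (taylor n (deg col) (exponent i ℕ.+ suc L) (ρ q) (ε ρ) bound) ⟩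
      horner (exponent i ℕ.+ suc L) (ε ρ) (c i) (λ e → divided (n ∸ e) (deg col) (ρ q))
        ≡⟨ horner-split (exponent i) (suc L) (ε ρ) (c i) (λ e → divided (n ∸ e) (deg col) (ρ q)) ⟩
      V ρ i col + ε ρ ^ exponent i * horner (suc L) (ε ρ) (c′ i) (λ d → divided (n ∸ (exponent i ℕ.+ d)) (deg col) (ρ q))
        ≡⟨ cong (λ t → V ρ i col + ε ρ ^ exponent i * t)
             (horner-cong (suc L) (ε ρ) (c′ i) (c′ i) (λ d → divided (n ∸ (exponent i ℕ.+ d)) (deg col) (ρ q)) (λ d → z d ρ col) λ d _ →
               cong (λ k → c′ i d * divided k (deg col) (ρ q)) (index d)) ⟩
      V ρ i col + ε ρ ^ exponent i * U ρ i col ∎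
      where
      open ≡-Reasoning
      n : ℕ
      n = L ℕ.+ exponent i
      shift : ∀ x y → y + (x - y) ≡ x
      shift = solve-∀
      -- The total length i + 1 + (L + 1) is n + 1, just enough to include the term of order n.
      bound : n < exponent i ℕ.+ suc L
      bound = ℕ.≤-reflexive (trans (cong suc (ℕ.+-comm L (exponent i))) (sym (ℕ.+-suc (exponent i) L)))
      index : ∀ d → n ∸ (exponent i ℕ.+ d) ≡ L ∸ d
      index d = trans (sym (ℕ.∸-+-assoc n (exponent i) d)) (cong (_∸ d) (ℕ.m+n∸n≡m L (exponent i)))
    span : ∀ ρ i → InSpan (λ r → ∀ j → r ≢ row j) (selected ρ) (V ρ i)
    span ρ i = InSpan-horner (exponent i) (ε ρ) (c i) (λ e col → divided (L ℕ.+ exponent i ∸ e) (deg col) (ρ q)) multiple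
      where
      multiple : ∀ e → e < exponent i → Σ ℤ λ x → Σ (Fin (sumℕ ν)) λ r → Σ (∀ j → r ≢ row j) λ _ →
        ∀ col → divided (L ℕ.+ exponent i ∸ e) (deg col) (ρ q) ≡ x * selected ρ r col
      -- The term of order e ≤ i belongs to x ^ (L + (i - e) + 1), that is, to row i - e of block q.
      -- This row exists because i < ν p ≤ ν q.
      multiple e (ℕ.s≤s e≤i) = ρ q ^ suc (toℕ t) , blockRow ν q t , (λ j → blockRow-disjoint ν (p≢q ∘ sym)) ,
        λ col → trans (cong (λ n → divided n (deg col) (ρ q)) index) (selected-multiple ρ q t col)
        where
        t< : toℕ i ∸ e < ν q
        t< = ℕ.≤-trans (ℕ.s≤s (ℕ.m∸n≤m (toℕ i) e)) (ℕ.≤-trans (Fin.toℕ<n i) νp≤νq)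
        t : Fin (ν q)
        t = fromℕ< t<
        index : L ℕ.+ exponent i ∸ e ≡ L ℕ.+ suc (toℕ t)
        index = trans (ℕ.+-∸-assoc L (ℕ.m≤n⇒m≤1+n e≤i))
          (cong (L ℕ.+_) (trans (ℕ.+-∸-assoc 1 e≤i) (cong suc (sym (Fin.toℕ-fromℕ< t<)))))
    scale-polynomial : IsPolynomial scale
    scale-polynomial = go S
      where
      go : ∀ S → IsPolynomial (λ ρ → foldr _*_ 1ℤ (map (λ i → ρ p ^ exponent i) S))
      go []      = constant 1ℤ
      go (i ∷ S) = power (coordinate p) (exponent i) ⊗ go S
    scale≢0 : scale (eliminate p (coordinate q) generic) ≢ 0ℤ
    scale≢0 = go S
      where
      x : ℤ
      x = eliminate p (coordinate q) generic p
      x≢0 : x ≢ 0ℤ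
      x≢0 x≡0 with trans (sym (updateAt-updates p (generic {m}))) x≡0
      ... | ()
      go : ∀ S → foldr _*_ 1ℤ (map (λ i → x ^ exponent i) S) ≢ 0ℤ
      go []      ()
      go (i ∷ S) eq = [ power≢0 (exponent i) x≢0 , go S ]′ (i*j≡0⇒i≡0∨j≡0 (x ^ exponent i) eq)
    exponent-sum : sum (map exponent S) ℕ.+ triangle (length (map row S)) ≡ ν p ℕ.^ 2
    exponent-sum = trans
      (cong₂ (λ s k → s ℕ.+ triangle k)
        (trans (cong sum (map-tabulate {n = ν p} id exponent)) (sum-arithmetic 1 (ν p)))
        (trans (length-map row S) (length-tabulate {n = ν p} id)))
      (triangles-square (ν p))
    combine : (λ ρ → ε ρ ^ triangle (length (map row S))) ∣ᴾ (λ ρ → det (cleared ρ)) →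
              (λ ρ → ε ρ ^ (ν p ℕ.^ 2)) ∣ᴾ (λ ρ → scale ρ * det (selected ρ))
    combine (divides {f} F eq) = divides F λ ρ → begin
      scale ρ * det (selected ρ)
        ≡⟨ det-replaceRows row (blockRow-injective ν p) (ε ρ) (λ i → ρ p ^ exponent i) exponent (U ρ) (V ρ) S (selected ρ)
             S-unique (span ρ) (All.universal (λ i → expansion ρ i) S) ⟩
      ε ρ ^ s * det (cleared ρ)               ≡⟨ cong (ε ρ ^ s *_) (eq ρ) ⟩
      ε ρ ^ s * (ε ρ ^ t * f ρ)               ≡⟨ sym (*-assoc (ε ρ ^ s) (ε ρ ^ t) (f ρ)) ⟩
      ε ρ ^ s * ε ρ ^ t * f ρ                 ≡⟨ cong (_* f ρ) (sym (^-distribˡ-+-* (ε ρ) s t)) ⟩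
      ε ρ ^ (s ℕ.+ t) * f ρ                   ≡⟨ cong (λ e → ε ρ ^ e * f ρ) exponent-sum ⟩
      ε ρ ^ (ν p ℕ.^ 2) * f ρ                 ∎
      where
      open ≡-Reasoning
      s t : ℕ
      s = sum (map exponent S)
      t = triangle (length (map row S))

-- Products of coprime factors

module _ {m : ℕ} where

  private
    Fun : Set
    Fun = Vector ℤ m → ℤ

  product-polynomial : ∀ {n} {g : Fin n → Fun} → (∀ k → IsPolynomial (g k)) →
    IsPolynomial (λ ρ → productℤ (λ k → g k ρ))
  product-polynomial {zero}  G = constant 1ℤ
  product-polynomial {suc n} G = G zero ⊗ product-polynomial (G ∘ suc)

  ∣ᴾ-product : ∀ {n} {g : Fin n → Fun} {f : Fun} → (∀ k → IsPolynomial (g k)) →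
    (λ ρ → productℤ (λ k → g k ρ)) ∣ᴾ f → ∀ k → g k ∣ᴾ f
  ∣ᴾ-product {suc n} {g} G (divides {q} Q eq) zero =
    divides (product-polynomial (G ∘ suc) ⊗ Q) λ ρ →
      trans (eq ρ) (*-assoc (g zero ρ) (productℤ (λ k → g (suc k) ρ)) (q ρ))
  ∣ᴾ-product {suc n} {g} G (divides {q} Q eq) (suc k) =
    ∣ᴾ-product {g = g ∘ suc} (G ∘ suc) (divides (G zero ⊗ Q) λ ρ →
      trans (eq ρ) (xy∙z≈y∙xz (g zero ρ) (productℤ (λ k → g (suc k) ρ)) (q ρ))) k

  coprime-*-∣ᴾ : ∀ {g h f : Fun} → g CoprimeTo h → g ∣ᴾ f → h ∣ᴾ f → (λ ρ → g ρ * h ρ) ∣ᴾ f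
  coprime-*-∣ᴾ {g} {h} {f} coprime (divides {q} Q f≡gq) h∣f = combine (coprime .cancel Q (∣ᴾ-respects f≡gq h∣f))
    where
    combine : h ∣ᴾ q → (λ ρ → g ρ * h ρ) ∣ᴾ f
    combine (divides {r} R q≡hr) = divides R λ ρ →
      trans (f≡gq ρ) (trans (cong (g ρ *_) (q≡hr ρ)) (sym (*-assoc (g ρ) (h ρ) (r ρ))))

  PairwiseCoprime : ∀ {n} → (Fin n → Fun) → Set
  PairwiseCoprime g = ∀ {k k′} → k ≢ k′ → g k CoprimeTo g k′

  product-∣ᴾ : ∀ {n} {g : Fin n → Fun} {f : Fun} → (∀ k → IsPolynomial (g k)) → IsPolynomial f →
    PairwiseCoprime g → (∀ k → g k ∣ᴾ f) → (λ ρ → productℤ (λ k → g k ρ)) ∣ᴾ f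

  -- Each h k divides g f, hence f, and `product-∣ᴾ` reassembles the product. The recursion is
  -- mutual: `product-∣ᴾ` for n + 1 factors needs this lemma for n.
  coprimeTo-product : ∀ {n} {g : Fun} {h : Fin n → Fun} → IsPolynomial g → (∀ k → IsPolynomial (h k)) →
    PairwiseCoprime h → (∀ k → g CoprimeTo h k) → g CoprimeTo (λ ρ → productℤ (λ k → h k ρ))

  product-∣ᴾ {zero}      G F coprime g∣f = 1∣ᴾ F
  product-∣ᴾ {suc n} {g} {f} G F coprime g∣f = coprime-*-∣ᴾ {g zero}
    (coprimeTo-product (G zero) (G ∘ suc) (λ k≢k′ → coprime (k≢k′ ∘ Fin.suc-injective)) (λ k → coprime λ ()))
    (g∣f zero)
    (product-∣ᴾ {g = g ∘ suc} (G ∘ suc) F (λ k≢k′ → coprime (k≢k′ ∘ Fin.suc-injective)) (g∣f ∘ suc))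

  coprimeTo-product {g = g} {h} G H pairwise coprime .cancel {f} F ∏∣gf =
    product-∣ᴾ {g = h} H F pairwise λ k → coprime k .cancel F (∣ᴾ-product {g = h} H ∏∣gf k)

  product-coprimeTo : ∀ {n} {g : Fin n → Fun} {h : Fun} → (∀ k → IsPolynomial (g k)) →
    (∀ k → g k CoprimeTo h) → (λ ρ → productℤ (λ k → g k ρ)) CoprimeTo h
  product-coprimeTo {zero}  {g} {h} G coprime .cancel {f} F h∣f = ∣ᴾ-respects (λ ρ → *-identityˡ (f ρ)) h∣f
  product-coprimeTo {suc n} {g} {h} G coprime .cancel {f} F h∣gf =
    product-coprimeTo {g = g ∘ suc} (G ∘ suc) (coprime ∘ suc) .cancel F
      (coprime zero .cancel (product-polynomial (G ∘ suc) ⊗ F)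
        (∣ᴾ-respects (λ ρ → *-assoc (g zero ρ) (productℤ (λ k → g (suc k) ρ)) (f ρ)) h∣gf))

  coordinate-power-coprime : ∀ {j k : Fin m} → j ≢ k → ∀ e e′ → (λ ρ → ρ j ^ e) CoprimeTo (λ ρ → ρ k ^ e′)
  coordinate-power-coprime {j} {k} j≢k e e′ = power-coprime {ℓ = λ ρ → ρ k} {generic} G (coordinate k) (λ ()) coprime e′
    where
    G : IsPolynomial (λ (ρ : Vector ℤ m) → ρ j ^ e)
    G = power (coordinate j) e
    coprime : (λ ρ → ρ j ^ e) CoprimeTo (λ ρ → ρ k)
    -- The form x_k is treated as x_k - 0, so that the substitution is x_k = 0.
    coprime .cancel F k∣ = ∣ᴾ-respectsˡ (λ ρ → +-identityʳ (ρ k))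
      (linear-coprime k (constant 0ℤ) (λ _ → refl) {v = generic} G
        (power≢0 e (λ eq → nonzero (trans (sym (updateAt-minimal j k generic j≢k)) eq))) .cancel F
        (∣ᴾ-respectsˡ (λ ρ → sym (+-identityʳ (ρ k))) k∣))
      where
      nonzero : generic j ≢ 0ℤ
      nonzero ()

  eliminate-generic≢0 : ∀ (p q j : Fin m) → eliminate p (coordinate q) generic j ≢ 0ℤ
  eliminate-generic≢0 p q j eq with j Fin.≟ p
  ... | yes refl with trans (sym (updateAt-updates p generic)) eq
  ...   | ()
  eliminate-generic≢0 p q j eq | no j≢p with trans (sym (updateAt-minimal j p generic j≢p)) eq
  ...   | ()

  coordinate-difference-coprime : ∀ {j p q : Fin m} → p ≢ q → ∀ e e′ →
    (λ ρ → ρ j ^ e) CoprimeTo (λ ρ → (ρ p - ρ q) ^ e′)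
  coordinate-difference-coprime {j} {p} {q} p≢q e =
    difference-power-coprime p q p≢q (power (coordinate j) e) (power≢0 e (eliminate-generic≢0 p q j))

  -- After x_r is replaced by x_s, coordinates r and s are the only ones of `generic` that coincide.
  -- The pair (p , q) is not (r , s) by assumption and not (s , r) by the orderings.
  differences-coprime : ∀ {p q r s : Fin m} → p <ᶠ q → r <ᶠ s → (p , q) ≢ (r , s) → ∀ e e′ →
    (λ ρ → (ρ p - ρ q) ^ e) CoprimeTo (λ ρ → (ρ r - ρ s) ^ e′)
  differences-coprime {p} {q} {r} {s} p<q r<s pq≢rs e =
    difference-power-coprime r s (Fin.<⇒≢ r<s) (power (coordinate p ⊖ coordinate q) e)
      (power≢0 e (difference≢0 distinct))
    where
    v : Vector ℤ m
    v = eliminate r (coordinate s) generic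
    at-r : v r ≡ generic s
    at-r = updateAt-updates r generic
    off-r : ∀ {i} → i ≢ r → v i ≡ generic i
    off-r {i} i≢r = updateAt-minimal i r generic i≢r
    distinct : v p ≢ v q
    distinct eq with p Fin.≟ r | q Fin.≟ r
    ... | yes refl | yes refl = Fin.<-irrefl refl p<q
    ... | yes refl | no q≢r   = pq≢rs (cong (p ,_) (sym (generic-injective (trans (sym at-r) (trans eq (off-r q≢r))))))
    ... | no p≢r   | yes refl = Fin.<-asym r<s (subst (_<ᶠ r) (generic-injective (trans (sym (off-r p≢r)) (trans eq at-r))) p<q)
    ... | no p≢r   | no q≢r   = Fin.<⇒≢ p<q (generic-injective (trans (sym (off-r p≢r)) (trans eq (off-r q≢r))))

  ∣ᴾ-swap-difference : ∀ p q e {f} → (λ (ρ : Vector ℤ m) → (ρ p - ρ q) ^ e) ∣ᴾ f → (λ ρ → (ρ q - ρ p) ^ e) ∣ᴾ f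
  ∣ᴾ-swap-difference p q e {f} (divides {g} G eq) = divides (constant (-1ℤ ^ e) ⊗ G) λ ρ →
    trans (eq ρ) (trans (cong (_* g ρ) (swap-power e (ρ p) (ρ q))) (*-assoc ((ρ q - ρ p) ^ e) (-1ℤ ^ e) (g ρ)))
    where
    swap-power : ∀ e x y → (x - y) ^ e ≡ (y - x) ^ e * -1ℤ ^ e
    swap-power zero    x y = refl
    swap-power (suc e) x y = trans (cong ((x - y) *_) (swap-power e x y)) (rearrange x y ((y - x) ^ e) (-1ℤ ^ e))
      where
      rearrange : ∀ x y a b → (x - y) * (a * b) ≡ (y - x) * a * (-1ℤ * b)
      rearrange = solve-∀

  -- Has the form of the factors in `product-<`, so that `divisor` unfolds to products over all i
  -- and j, where the pairs without i < j contribute 1.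
  guarded : {P : Set} → Dec P → Fun → Fun
  guarded P? g ρ = if does P? then g ρ else 1ℤ

  guarded-polynomial : ∀ {P g} (P? : Dec P) → IsPolynomial g → IsPolynomial (guarded P? g)
  guarded-polynomial (yes _) G = G
  guarded-polynomial (no _)  G = constant 1ℤ

  guarded-∣ᴾ : ∀ {P g f} (P? : Dec P) → IsPolynomial f → (P → g ∣ᴾ f) → guarded P? g ∣ᴾ f
  guarded-∣ᴾ (yes p) F g∣f = g∣f p
  guarded-∣ᴾ (no _)  F g∣f = 1∣ᴾ F

  coprimeTo-guarded : ∀ {P g h} (P? : Dec P) → (P → g CoprimeTo h) → g CoprimeTo guarded P? h
  coprimeTo-guarded (yes p) coprime = coprime p
  coprimeTo-guarded (no _)  coprime .cancel F _ = 1∣ᴾ F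

  guarded-coprimeTo : ∀ {P g h} (P? : Dec P) → (P → g CoprimeTo h) → guarded P? g CoprimeTo h
  guarded-coprimeTo (yes p) coprime = coprime p
  guarded-coprimeTo (no _)  coprime .cancel {f} F h∣f = ∣ᴾ-respects (λ ρ → *-identityˡ (f ρ)) h∣f

-- The divisor and the maximal minors

module _ {m} (ν : Vector ℕ m) where

  pairExponent : Fin m → Fin m → ℕ
  pairExponent i j = (ν i ℕ.^ 2) ⊓ (ν j ℕ.^ 2)

  pairFactor : Fin m → Fin m → Vector ℤ m → ℤ
  pairFactor i j = guarded (i Fin.<? j) (λ ρ → (ρ i - ρ j) ^ pairExponent i j)

  pairFactor-polynomial : ∀ i j → IsPolynomial (pairFactor i j)
  pairFactor-polynomial i j = guarded-polynomial (i Fin.<? j) (power (coordinate i ⊖ coordinate j) (pairExponent i j))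

  power-coprimeTo-pairFactor : ∀ k e i j → (λ ρ → ρ k ^ e) CoprimeTo pairFactor i j
  power-coprimeTo-pairFactor k e i j = coprimeTo-guarded (i Fin.<? j) λ i<j →
    coordinate-difference-coprime (Fin.<⇒≢ i<j) e (pairExponent i j)

  pairFactors-coprime : ∀ {i j i′ j′} → (i , j) ≢ (i′ , j′) → pairFactor i j CoprimeTo pairFactor i′ j′
  pairFactors-coprime {i} {j} {i′} {j′} ij≢ =
    coprimeTo-guarded (i′ Fin.<? j′) λ i′<j′ → guarded-coprimeTo (i Fin.<? j) λ i<j →
      differences-coprime i<j i′<j′ ij≢ (pairExponent i j) (pairExponent i′ j′)

  divisor : Vector ℤ m → ℤ
  divisor ρ = productℤ (λ j → ρ j ^ (ν j C 2)) * product-< (λ i j → (ρ i - ρ j) ^ pairExponent i j)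

  module _ (L : ℕ) (γ : Fin (sumℕ ν) → Fin (suc L)) where

    -- `difference-power-divides` requires the smaller block first. If that is block j, the
    -- difference changes sign. The minimum of the squares is the square of the minimum.
    pairFactor-divides : ∀ i j → pairFactor i j ∣ᴾ (λ ρ → det (selected ν L γ ρ))
    pairFactor-divides i j = guarded-∣ᴾ (i Fin.<? j) (det-polynomial (selected-polynomial ν L γ)) λ i<j →
      [ smaller i<j , larger i<j ]′ (ℕ.≤-total (ν i) (ν j))
      where
      Divides : ℕ → Set
      Divides e = (λ ρ → (ρ i - ρ j) ^ e) ∣ᴾ (λ ρ → det (selected ν L γ ρ))
      smaller : i <ᶠ j → ν i ≤ ν j → Divides (pairExponent i j)
      smaller i<j νi≤νj = subst Divides (sym (ℕ.m≤n⇒m⊓n≡m (ℕ.^-monoˡ-≤ 2 νi≤νj)))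
        (difference-power-divides ν L γ (Fin.<⇒≢ i<j) νi≤νj)
      larger : i <ᶠ j → ν j ≤ ν i → Divides (pairExponent i j)
      larger i<j νj≤νi = subst Divides (sym (ℕ.m≥n⇒m⊓n≡n (ℕ.^-monoˡ-≤ 2 νj≤νi)))
        (∣ᴾ-swap-difference j i (ν j ℕ.^ 2) (difference-power-divides ν L γ (Fin.<⇒≢ i<j ∘ sym) νj≤νi))

    -- Coprimality of single powers of linear forms is extended to products over j, then over i, and
    -- finally to the two main products.
    divisor-divides : divisor ∣ᴾ (λ ρ → det (selected ν L γ ρ))
    divisor-divides = coprime-*-∣ᴾ
      (product-coprimeTo {g = λ j ρ → ρ j ^ (ν j C 2)} powers-polynomial λ k →
        coprimeTo-product {h = rowFactor} (powers-polynomial k) rowFactor-polynomial rowFactors-coprime λ i →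
          coprimeTo-product {h = pairFactor i} (powers-polynomial k) (pairFactor-polynomial i) (row-coprime i)
            (power-coprimeTo-pairFactor k (ν k C 2) i))
      (product-∣ᴾ {g = λ j ρ → ρ j ^ (ν j C 2)} powers-polynomial F
        (λ {j} {k} j≢k → coordinate-power-coprime j≢k (ν j C 2) (ν k C 2))
        (λ j → subst (λ e → (λ ρ → ρ j ^ e) ∣ᴾ (λ ρ → det (selected ν L γ ρ))) (triangle≡nC2 (ν j))
          (coordinate-power-divides ν L γ j)))
      (product-∣ᴾ {g = rowFactor} rowFactor-polynomial F rowFactors-coprime λ i →
        product-∣ᴾ {g = pairFactor i} (pairFactor-polynomial i) F (row-coprime i) (pairFactor-divides i))
      where
      F : IsPolynomial (λ ρ → det (selected ν L γ ρ))
      F = det-polynomial (selected-polynomial ν L γ)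
      powers-polynomial : ∀ j → IsPolynomial (λ (ρ : Vector ℤ m) → ρ j ^ (ν j C 2))
      powers-polynomial j = power (coordinate j) (ν j C 2)
      rowFactor : Fin m → Vector ℤ m → ℤ
      rowFactor i ρ = productℤ (λ j → pairFactor i j ρ)
      rowFactor-polynomial : ∀ i → IsPolynomial (rowFactor i)
      rowFactor-polynomial i = product-polynomial (pairFactor-polynomial i)
      row-coprime : ∀ i → PairwiseCoprime (pairFactor i)
      row-coprime i j≢j′ = pairFactors-coprime λ { refl → j≢j′ refl }
      rowFactors-coprime : PairwiseCoprime rowFactor
      rowFactors-coprime {i} {i′} i≢i′ = product-coprimeTo {g = pairFactor i} (pairFactor-polynomial i) λ j →
        coprimeTo-product {h = pairFactor i′} (pairFactor-polynomial i j) (pairFactor-polynomial i′) (row-coprime i′)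
          λ j′ → pairFactors-coprime λ { refl → i≢i′ refl }

-- Specialization to integers and the gcd

evaluate : ∀ {m} {g f : Vector ℤ m → ℤ} → g ∣ᴾ f → ∀ ρ → g ρ ∣ f ρ
evaluate {g = g} (divides {q} _ eq) ρ = ℤ.divides (q ρ) (trans (eq ρ) (*-comm (g ρ) (q ρ)))

∣-gcdList : ∀ {k xs} → All (k ∣_) xs → k ∣ gcdList xs
∣-gcdList []                  = ℤ.divides 0ℤ refl
∣-gcdList {k} {x ∷ xs} (k∣x ∷ k∣xs) =
  ℤ.∣ᵤ⇒∣ (gcd-greatest {x} {gcdList xs} {k} (ℤ.∣⇒∣ᵤ k∣x) (ℤ.∣⇒∣ᵤ (∣-gcdList k∣xs)))

theorem2p1 : ∀ (m : ℕ) → 1 ≤ m →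
    (ν l : Vector ℕ m) → (∀ j → 1 ≤ ν j) → (∀ j → ν j ≤ l j) →
    (a : Vector ℤ m) →
    productℤ (λ j → a j ^ (ν j C 2))
    * product-< (λ i j → (a i - a j) ^ ((ν i ℕ.^ 2) ⊓ (ν j ℕ.^ 2)))
    ∣ D ν l a
theorem2p1 m _ ν l _ _ a = ∣-gcdList (All.map⁺ (All.universal minor-divisible (increasing (sumℕ ν) (suc (sumℕ l)))))
  where
  minor-divisible : ∀ cs → divisor ν a ∣ det (λ r c → 𝒱 ν l a r (lookup cs c))
  -- The point `a` is inserted only after all factors have been combined, since coprime polynomials
  -- may take values with common factors.
  minor-divisible cs = evaluate (divisor-divides ν (sumℕ l) (lookup cs)) a
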